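{- Let $b \in \{1,2,3\}$. Put $x_0 := 1$ if $b$ is odd and $x_0 := 2$ if $b$ is even, and put $a_0 := b+2$. Then for every integer $a \geq a_0$ and every real number $x > x_0$, $$\Delta_{a,b}(x) = P_{a-1}(x)\,P_{b+1}(x) - P_a(x)\,P_b(x) > 0.$$
   Context: The polynomials $P_n(x)$, $n \geq 0$, are defined by the generating function $\sum_{n=0}^{\infty} P_n(z)\, q^n = \prod_{n=1}^{\infty} (1-q^n)^{ -z}$ for $q,z \in \mathbb{C}$, $|q|<1$ (so $P_0(x)=1$, $P_1(x)=x$, $P_2(x)=x(x+3)/2$, and $P_n(k)$ is the number of $k$-colored partitions of $n$). For integers $a > b \geq 0$, $\Delta_{a,b}(x) := P_{a-1}(x)P_{b+1}(x) - P_a(x)P_b(x)$. -}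

module Defs where

open import Level using (0ℓ)
open import Data.Nat as ℕ using (ℕ; zero; suc; _∸_; _≡ᵇ_; _%_)
open import Data.Bool using (if_then_else_)
open import Data.Product using (∃; _×_)
open import Data.Sum using (_⊎_)
open import Relation.Nullary using (¬_)
open import Relation.Binary.PropositionalEquality using (_≡_)
open import Relation.Binary.Structures using (IsStrictTotalOrder)
open import Algebra.Structures using (IsCommutativeRing)

-- The real numbers, given axiomatically as a complete ordered field
-- (unique up to isomorphism).  Equality is propositional equality.
record RealField : Set₁ where
  infixl 6 _+_ _-_
  infixl 7 _*_
  infix 4 _<_ _≤_
  field
    Carrier : Set
    _+_ _*_ : Carrier → Carrier → Carrier
    -_      : Carrier → Carrier
    0# 1#   : Carrier
    isCommutativeRing : IsCommutativeRing _≡_ _+_ _*_ -_ 0# 1#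
    _⁻¹     : Carrier → Carrier
    ⁻¹-inverse : ∀ x → ¬ (x ≡ 0#) → x * (x ⁻¹) ≡ 1#
    0≢1     : ¬ (0# ≡ 1#)
    _<_     : Carrier → Carrier → Set
    isStrictTotalOrder : IsStrictTotalOrder _≡_ _<_
    +-mono-< : ∀ {x y} z → x < y → x + z < y + z
    *-pos    : ∀ {x y} → 0# < x → 0# < y → 0# < x * y

  _≤_ : Carrier → Carrier → Set
  x ≤ y = x < y ⊎ x ≡ y

  _-_ : Carrier → Carrier → Carrier
  x - y = x + (- y)

  field
    complete : (S : Carrier → Set) → ∃ S → ∃ (λ u → ∀ s → S s → s ≤ u) →
               ∃ (λ u → (∀ s → S s → s ≤ u) × (∀ v → (∀ s → S s → s ≤ v) → u ≤ v))

module _ (R : RealField) where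
  open RealField R

  fromℕ : ℕ → Carrier
  fromℕ zero    = 0#
  fromℕ (suc n) = 1# + fromℕ n

  sumTo : (ℕ → Carrier) → ℕ → Carrier
  sumTo f zero    = f zero
  sumTo f (suc n) = sumTo f n + f (suc n)

  -- formal power series in q as coefficient sequences; Cauchy product
  Series : Set
  Series = ℕ → Carrier

  mulS : Series → Series → Series
  mulS f g n = sumTo (λ i → f i * g (n ∸ i)) n

  oneS : Series
  oneS zero    = 1#
  oneS (suc _) = 0#

  factorial : ℕ → Carrier
  factorial zero    = 1#
  factorial (suc n) = fromℕ (suc n) * factorial n

  rising : Carrier → ℕ → Carrier
  rising z zero    = 1#
  rising z (suc j) = rising z j * (z + fromℕ j)

  -- binom(z+j-1, j) = coefficient of t^j in (1-t)^{-z}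
  negBinom : Carrier → ℕ → Carrier
  negBinom z j = rising z j * (factorial j ⁻¹)

  -- (1 - q^m)^{-z} = Σ_j binom(z+j-1,j) q^{m j}
  factorS : Carrier → ℕ → Series
  factorS z m k = sumTo (λ j → if (m ℕ.* j) ≡ᵇ k then negBinom z j else 0#) k

  prodS : Carrier → ℕ → Series
  prodS z zero    = oneS
  prodS z (suc N) = mulS (prodS z N) (factorS z (suc N))

  -- P_n(z) = coefficient of q^n in Π_{m≥1} (1-q^m)^{-z}
  -- (factors with m > n do not contribute to the q^n coefficient)
  P : ℕ → Carrier → Carrier
  P n z = prodS z n n

  Δ : ℕ → ℕ → Carrier → Carrier
  Δ a b x = P (a ∸ 1) x * P (suc b) x - P a x * P b x

x₀ : ℕ → ℕ
x₀ b = if (b % 2) ≡ᵇ 0 then 2 else 1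

-- Write σ for the divisor sum.  Logarithmic differentiation of the Euler product gives
-- n P_n(x) = x Σ_{k≥1} σ(k) P_{n-k}(x).  Comparing the recurrences for n P_b P_n and (n-1) P_{b+1} P_{n-1},
-- the inequalities P_b P_{m+1} ≤ P_{b+1} P_m for b ≤ m < n-1 leave as an error only the terms with
-- P_0, …, P_b, at most x P_b σ_max (P_0 + ⋯ + P_b), and this is smaller than the surplus P_{b+1} P_{n-1}
-- as soon as P_{n-1} > 4 σ_max (P_0 + P_1 + P_2 + P_3).  The latter holds for x > 1 and n ≥ 44, because
-- σ(k) ≥ k makes P_{s+3} ≥ (P_0 + P_1 + P_2 + P_3) (s + 5 choose 5) / 300 inductive from s = 40 on, while
-- σ_max is at most quadratic.  The remaining finitely many inequalities hold coefficientwise after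
-- substituting x = c + t with c = 1 or 2, and are decided by evaluation.
module Submission where

open import Defs
open import Algebra.Bundles using (CommutativeRing)
import Algebra.Solver.Ring.NaturalCoefficients.Default as SemiringSolver
open import Data.Bool using (Bool; true; false; _∧_; _∨_; T; if_then_else_)
open import Data.Bool.Properties using (T-∧; T-∨)
open import Data.Empty using (⊥-elim)
open import Data.List using (List; []; _∷_; map; drop)
import Data.Nat as ℕ
open import Data.Nat using (ℕ; zero; suc; z≤n; s≤s; s≤s⁻¹; _∸_; _%_; _≡ᵇ_; _≤ᵇ_; _!)
import Data.Nat.Properties as ℕₚ
open import Data.Nat.Divisibility using (_∣_; _∣?_; divides; ∣m+n∣m⇒∣n; ∣-refl; ∣⇒≤)
open import Data.Nat.DivMod using (n%n≡0; m<n⇒m%n≡m; [m+n]%n≡m%n)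
open import Data.Nat.Induction using (<-rec)
open import Data.Nat.Solver using (module +-*-Solver)
open import Data.Product using (_,_; proj₁; proj₂)
open import Data.Sum using (inj₁; inj₂)
open import Function.Base using (_∘_)
open import Function.Bundles using (Equivalence)
open import Relation.Binary.Bundles using (StrictPartialOrder)
open import Relation.Binary.Definitions using (tri<; tri≈; tri>)
import Relation.Binary.Reasoning.StrictPartialOrder as StrictReasoning
open import Relation.Binary.Structures using (IsStrictTotalOrder)
open import Relation.Binary.PropositionalEquality
  using (_≡_; _≗_; refl; sym; trans; cong; cong₂; subst; module ≡-Reasoning)
open import Relation.Nullary using (¬_; yes; no)

-- The estimate for large n has to be uniform in the unbounded variable x. As P_0 + P_1 + P_2 + P_3
-- has degree 3 in x, the lower bound for P_{n-1} is kept proportional to this sum, so that neither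
-- quantity has to be bounded numerically. Summing up to index 3 for every b lets one growth
-- estimate serve all three cases.
--
-- The binomial degree 5 has to exceed 2, the degree of the bound on σ_max. With the factor 1/300,
-- the bound on P_{n-1} beats 4 σ_max (P_0 + P_1 + P_2 + P_3) from s = 40 on and not earlier, and s
-- = 40 is also where the inductive step of the growth estimate starts to hold; both thresholds lead
-- to n = 44.
--
-- Multiplication by n! removes the division by n from the recurrence, so n! P_n(c + t) has natural
-- coefficients in t. A comparison of coefficients is then a finite computation that is valid for
-- all t > 0 at once.

-- Divisor sums

-- The term m + 1 of the divisor sum σ(k), present when m + 1 divides k > 0.
divTerm : ℕ → ℕ → ℕ
divTerm m zero    = 0
divTerm m (suc k) = if (suc k % suc m) ≡ᵇ 0 then suc m else 0

σ≤ : ℕ → ℕ → ℕ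
σ≤ zero    k = 0
σ≤ (suc N) k = σ≤ N k ℕ.+ divTerm N k

σ : ℕ → ℕ
σ k = σ≤ k k

triangle : ℕ → ℕ
triangle zero    = 0
triangle (suc n) = triangle n ℕ.+ suc n

divTerm-small : ∀ m k → k ℕ.≤ m → divTerm m k ≡ 0
divTerm-small m zero    _   = refl
divTerm-small m (suc k) k≤m rewrite m<n⇒m%n≡m (s≤s k≤m) = refl

divTerm-self : ∀ m → divTerm m (suc m) ≡ suc m
divTerm-self m rewrite n%n≡0 (suc m) {{_}} = refl

-- The argument `suc k` matters: `divTerm m 0` is 0 by convention although m + 1 divides 0. This
-- defect at 0 returns as the correction term of `ℓ-period`.
divTerm-period : ∀ m k → divTerm m (suc m ℕ.+ suc k) ≡ divTerm m (suc k)
divTerm-period m k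
  rewrite ℕₚ.+-comm m (suc k) | sym (ℕₚ.+-suc (suc k) m) | [m+n]%n≡m%n (suc k) (suc m) {{_}} = refl

divTerm≤ : ∀ m k → divTerm m k ℕ.≤ suc m
divTerm≤ m zero = z≤n
divTerm≤ m (suc k) with (suc k % suc m) ≡ᵇ 0
... | true  = ℕₚ.≤-refl
... | false = z≤n

σ≤-stable : ∀ d k → σ≤ (d ℕ.+ k) k ≡ σ k
σ≤-stable zero    k = refl
σ≤-stable (suc d) k
  rewrite divTerm-small (d ℕ.+ k) k (ℕₚ.m≤n+m k d) | ℕₚ.+-identityʳ (σ≤ (d ℕ.+ k) k) = σ≤-stable d k

k≤σ : ∀ k → k ℕ.≤ σ k
k≤σ zero    = z≤n
k≤σ (suc k) = ℕₚ.≤-trans (ℕₚ.≤-reflexive (sym (divTerm-self k))) (ℕₚ.m≤n+m _ (σ≤ k (suc k)))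

σ≤triangle : ∀ N k → σ≤ N k ℕ.≤ triangle N
σ≤triangle zero    k = z≤n
σ≤triangle (suc N) k = ℕₚ.+-mono-≤ (σ≤triangle N k) (divTerm≤ N k)

triangle-mono : ∀ {m n} → m ℕ.≤ n → triangle m ℕ.≤ triangle n
triangle-mono z≤n       = z≤n
triangle-mono (s≤s m≤n) = ℕₚ.+-mono-≤ (triangle-mono m≤n) (s≤s m≤n)

σ-bound : ∀ {k n} → k ℕ.≤ n → σ k ℕ.≤ triangle n
σ-bound {k} k≤n = ℕₚ.≤-trans (σ≤triangle k k) (triangle-mono k≤n)

-- Simplicial numbers and their growth

-- simplicial d s is the binomial coefficient (s + d choose d).
simplicial : ℕ → ℕ → ℕ
simplicial zero    s       = 1
simplicial (suc d) zero    = 1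
simplicial (suc d) (suc s) = simplicial (suc d) s ℕ.+ simplicial d (suc s)

simplicial-zero : ∀ d → simplicial d 0 ≡ 1
simplicial-zero zero    = refl
simplicial-zero (suc d) = refl

simplicial-comm : ∀ d s → simplicial d s ≡ simplicial s d
simplicial-comm zero    s       = sym (simplicial-zero s)
simplicial-comm (suc d) zero    = refl
simplicial-comm (suc d) (suc s) = begin
  simplicial (suc d) s ℕ.+ simplicial d (suc s)  ≡⟨ cong₂ ℕ._+_ (simplicial-comm (suc d) s) (simplicial-comm d (suc s)) ⟩
  simplicial s (suc d) ℕ.+ simplicial (suc s) d  ≡⟨ ℕₚ.+-comm (simplicial s (suc d)) _ ⟩
  simplicial (suc s) d ℕ.+ simplicial s (suc d)  ∎
  where open ≡-Reasoning

-- The absorption identity for binomial coefficients. The inductive step needs it a second time with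
-- the roles of `d` and `s` exchanged, which the symmetry of the simplicial numbers permits.
simplicial-absorb : ∀ d s → suc d ℕ.* simplicial (suc d) s ≡ (suc d ℕ.+ s) ℕ.* simplicial d s
simplicial-absorb d zero = cong₂ ℕ._*_ (sym (ℕₚ.+-identityʳ (suc d))) (sym (simplicial-zero d))
simplicial-absorb zero (suc s) = begin
  1 ℕ.* (simplicial 1 s ℕ.+ 1)          ≡⟨ ℕₚ.*-distribˡ-+ 1 (simplicial 1 s) 1 ⟩
  1 ℕ.* simplicial 1 s ℕ.+ 1            ≡⟨ cong (ℕ._+ 1) (simplicial-absorb 0 s) ⟩
  (1 ℕ.+ s) ℕ.* 1 ℕ.+ 1                 ≡⟨ solve 1 (λ s → (con 1 :+ s) :* con 1 :+ con 1 := (con 1 :+ (con 1 :+ s)) :* con 1) refl s ⟩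
  (1 ℕ.+ suc s) ℕ.* 1                   ∎
  where open ≡-Reasoning
        open +-*-Solver
simplicial-absorb (suc d) (suc s) = begin
  suc (suc d) ℕ.* (A ℕ.+ B)                    ≡⟨ ℕₚ.*-distribˡ-+ (suc (suc d)) A B ⟩
  suc (suc d) ℕ.* A ℕ.+ suc (suc d) ℕ.* B      ≡⟨ cong (ℕ._+ suc (suc d) ℕ.* B) (simplicial-absorb (suc d) s) ⟩
  (suc (suc d) ℕ.+ s) ℕ.* simplicial (suc d) s ℕ.+ suc (suc d) ℕ.* B
                                               ≡⟨ cong (ℕ._+ suc (suc d) ℕ.* B) swap ⟩
  suc s ℕ.* B ℕ.+ suc (suc d) ℕ.* B            ≡⟨ solve 3 (λ s d B → (con 1 :+ s) :* B :+ (con 2 :+ d) :* B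
                                                    := (con 2 :+ d :+ (con 1 :+ s)) :* B) refl s d B ⟩
  (suc (suc d) ℕ.+ suc s) ℕ.* B                ∎
  where
  open ≡-Reasoning
  open +-*-Solver
  A = simplicial (suc (suc d)) s
  B = simplicial (suc d) (suc s)
  swap : (suc (suc d) ℕ.+ s) ℕ.* simplicial (suc d) s ≡ suc s ℕ.* B
  swap = begin
    (suc (suc d) ℕ.+ s) ℕ.* simplicial (suc d) s  ≡⟨ cong₂ ℕ._*_ (solve 2 (λ d s → con 2 :+ d :+ s := con 1 :+ s :+ (con 1 :+ d)) refl d s) (simplicial-comm (suc d) s) ⟩
    (suc s ℕ.+ suc d) ℕ.* simplicial s (suc d)    ≡⟨ simplicial-absorb s (suc d) ⟨
    suc s ℕ.* simplicial (suc s) (suc d)          ≡⟨ cong (suc s ℕ.*_) (simplicial-comm (suc s) (suc d)) ⟩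
    suc s ℕ.* B                                   ∎

-- `k * simplicial 6 s + simplicial 7 s` is the closed form of the sum over j ≤ s of (k + 1 + j)
-- `simplicial 5 (s - j)`; the identity splits off the term j = 0 of that sum for s + 1.
simplicial-step : ∀ k s → k ℕ.* simplicial 6 (suc s) ℕ.+ simplicial 7 (suc s)
                          ≡ suc k ℕ.* simplicial 5 (suc s) ℕ.+ (suc k ℕ.* simplicial 6 s ℕ.+ simplicial 7 s)
simplicial-step k s = solve 4 (λ k a b c → k :* (a :+ b) :+ (c :+ (a :+ b)) := (con 1 :+ k) :* b :+ ((con 1 :+ k) :* a :+ c))
                        refl k (simplicial 6 s) (simplicial 5 (suc s)) (simplicial 7 s)
  where open +-*-Solver

ascending : ℕ → ℕ → ℕ
ascending s zero    = 1
ascending s (suc d) = (suc d ℕ.+ s) ℕ.* ascending s d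

simplicial-ascending : ∀ d s → d ! ℕ.* simplicial d s ≡ ascending s d
simplicial-ascending zero    s = refl
simplicial-ascending (suc d) s = begin
  suc d ℕ.* d ! ℕ.* simplicial (suc d) s       ≡⟨ cong (ℕ._* simplicial (suc d) s) (ℕₚ.*-comm (suc d) (d !)) ⟩
  d ! ℕ.* suc d ℕ.* simplicial (suc d) s       ≡⟨ ℕₚ.*-assoc (d !) (suc d) _ ⟩
  d ! ℕ.* (suc d ℕ.* simplicial (suc d) s)     ≡⟨ cong (d ! ℕ.*_) (simplicial-absorb d s) ⟩
  d ! ℕ.* ((suc d ℕ.+ s) ℕ.* simplicial d s)   ≡⟨ solve 3 (λ f n S → f :* (n :* S) := n :* (f :* S)) refl (d !) (suc d ℕ.+ s) (simplicial d s) ⟩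
  (suc d ℕ.+ s) ℕ.* (d ! ℕ.* simplicial d s)   ≡⟨ cong ((suc d ℕ.+ s) ℕ.*_) (simplicial-ascending d s) ⟩
  (suc d ℕ.+ s) ℕ.* ascending s d              ∎
  where open ≡-Reasoning
        open +-*-Solver

-- 42 (s + 6 choose 7) = s (s + 6) (s + 5 choose 5), and s (s + 6) ≥ 42 (s + 3) from s = 40 on.
simplicial-growth : ∀ s → 39 ℕ.≤ s → (suc s ℕ.+ 3) ℕ.* simplicial 5 (suc s) ℕ.≤ simplicial 7 s
simplicial-growth s 39≤s = ℕₚ.*-cancelˡ-≤ 42 (begin
  42 ℕ.* ((suc s ℕ.+ 3) ℕ.* S₅)      ≡⟨ solve 2 (λ s S → con 42 :* ((con 1 :+ s :+ con 3) :* S) := (con 42 :* (s :+ con 4)) :* S) refl s S₅ ⟩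
  (42 ℕ.* (s ℕ.+ 4)) ℕ.* S₅          ≤⟨ ℕₚ.*-monoˡ-≤ S₅ quad ⟩
  ((7 ℕ.+ s) ℕ.* suc s) ℕ.* S₅       ≡⟨ ℕₚ.*-assoc (7 ℕ.+ s) (suc s) S₅ ⟩
  (7 ℕ.+ s) ℕ.* (suc s ℕ.* S₅)       ≡⟨ cong ((7 ℕ.+ s) ℕ.*_) six ⟨
  (7 ℕ.+ s) ℕ.* (6 ℕ.* S₆)           ≡⟨ solve 2 (λ s S → (con 7 :+ s) :* (con 6 :* S) := con 6 :* ((con 7 :+ s) :* S)) refl s S₆ ⟩
  6 ℕ.* ((7 ℕ.+ s) ℕ.* S₆)           ≡⟨ cong (6 ℕ.*_) (simplicial-absorb 6 s) ⟨
  6 ℕ.* (7 ℕ.* simplicial 7 s)       ≡⟨ ℕₚ.*-assoc 6 7 (simplicial 7 s) ⟨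
  42 ℕ.* simplicial 7 s              ∎)
  where
  open ℕₚ.≤-Reasoning
  open +-*-Solver
  S₅ = simplicial 5 (suc s)
  S₆ = simplicial 6 s
  six : 6 ℕ.* S₆ ≡ suc s ℕ.* S₅
  six = ℕₚ.+-cancelʳ-≡ (6 ℕ.* S₅) (6 ℕ.* S₆) (suc s ℕ.* S₅) (begin-equality
    6 ℕ.* S₆ ℕ.+ 6 ℕ.* S₅   ≡⟨ ℕₚ.*-distribˡ-+ 6 S₆ S₅ ⟨
    6 ℕ.* (S₆ ℕ.+ S₅)       ≡⟨ simplicial-absorb 5 (suc s) ⟩
    (6 ℕ.+ suc s) ℕ.* S₅    ≡⟨ solve 2 (λ s S → (con 7 :+ s) :* S := (con 1 :+ s) :* S :+ con 6 :* S) refl s S₅ ⟩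
    suc s ℕ.* S₅ ℕ.+ 6 ℕ.* S₅ ∎)
  quad : 42 ℕ.* (s ℕ.+ 4) ℕ.≤ (7 ℕ.+ s) ℕ.* suc s
  quad = begin
    42 ℕ.* (s ℕ.+ 4)                    ≡⟨ solve 1 (λ s → con 42 :* (s :+ con 4) := con 42 :* (con 1 :+ s) :+ con 126) refl s ⟩
    -- 46 is 7 + 39, the least value of 7 + s, and the excess 4 (s + 1) ≥ 160 pays for the 126. At s
    -- = 38 the bound fails.
    42 ℕ.* suc s ℕ.+ 126                ≤⟨ ℕₚ.+-monoʳ-≤ (42 ℕ.* suc s) (ℕₚ.≤-trans (ℕₚ.≤ᵇ⇒≤ 126 160 _) (ℕₚ.*-monoʳ-≤ 4 (s≤s 39≤s))) ⟩
    42 ℕ.* suc s ℕ.+ 4 ℕ.* suc s        ≡⟨ ℕₚ.*-distribʳ-+ (suc s) 42 4 ⟨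
    46 ℕ.* suc s                        ≤⟨ ℕₚ.*-monoˡ-≤ (suc s) (ℕₚ.+-monoʳ-≤ 7 39≤s) ⟩
    (7 ℕ.+ s) ℕ.* suc s                 ∎

module _ (K : ℕ) (base₃ : K ℕ.≤ simplicial 3 41) (base₄ : K ℕ.* 45 ℕ.≤ simplicial 4 41)
         (base₅ : K ℕ.* triangle 44 ℕ.< simplicial 5 40) where

  -- Differences turn the triangle numbers into a linear term and that term into the constant `K`,
  -- while the simplicial degree drops from 5 to 4 to 3. Hence three base values settle all larger
  -- indices.
  K≤simplicial₃ : ∀ e → K ℕ.≤ simplicial 3 (e ℕ.+ 41)
  K≤simplicial₃ zero    = base₃
  K≤simplicial₃ (suc e) = ℕₚ.≤-trans (K≤simplicial₃ e) (ℕₚ.m≤m+n _ _)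

  linear≤simplicial₄ : ∀ e → K ℕ.* (e ℕ.+ 45) ℕ.≤ simplicial 4 (e ℕ.+ 41)
  linear≤simplicial₄ zero    = base₄
  linear≤simplicial₄ (suc e) = begin
    K ℕ.* suc (e ℕ.+ 45)                                  ≡⟨ ℕₚ.*-suc K (e ℕ.+ 45) ⟩
    K ℕ.+ K ℕ.* (e ℕ.+ 45)                                ≡⟨ ℕₚ.+-comm K _ ⟩
    K ℕ.* (e ℕ.+ 45) ℕ.+ K                                ≤⟨ ℕₚ.+-mono-≤ (linear≤simplicial₄ e) (K≤simplicial₃ (suc e)) ⟩
    simplicial 4 (e ℕ.+ 41) ℕ.+ simplicial 3 (suc e ℕ.+ 41) ∎
    where open ℕₚ.≤-Reasoning

  triangle<simplicial₅ : ∀ e → K ℕ.* triangle (e ℕ.+ 44) ℕ.< simplicial 5 (e ℕ.+ 40)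
  triangle<simplicial₅ zero    = base₅
  triangle<simplicial₅ (suc e) = begin-strict
    K ℕ.* (triangle (e ℕ.+ 44) ℕ.+ suc (e ℕ.+ 44))              ≡⟨ ℕₚ.*-distribˡ-+ K (triangle (e ℕ.+ 44)) _ ⟩
    K ℕ.* triangle (e ℕ.+ 44) ℕ.+ K ℕ.* suc (e ℕ.+ 44)          ≡⟨ cong (λ n → K ℕ.* triangle (e ℕ.+ 44) ℕ.+ K ℕ.* n) (ℕₚ.+-suc e 44) ⟨
    K ℕ.* triangle (e ℕ.+ 44) ℕ.+ K ℕ.* (e ℕ.+ 45)              <⟨ ℕₚ.+-mono-<-≤ (triangle<simplicial₅ e) (linear≤simplicial₄ e) ⟩
    simplicial 5 (e ℕ.+ 40) ℕ.+ simplicial 4 (e ℕ.+ 41)         ≡⟨ cong (λ n → simplicial 5 (e ℕ.+ 40) ℕ.+ simplicial 4 n) (ℕₚ.+-suc e 40) ⟩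
    simplicial 5 (e ℕ.+ 40) ℕ.+ simplicial 4 (suc (e ℕ.+ 40))   ∎
    where open ℕₚ.≤-Reasoning

-- 1200 is 4 times 300, with the 4 of `ratio-step` and the 300 of the growth estimate. For s = e +
-- 40 the claim amounts to (s + 1)(s + 2)(s + 3) > 72000; the left side is 74046 at s = 40 but 68880
-- at s = 39.
triangle-growth : ∀ e → 1200 ℕ.* triangle (e ℕ.+ 44) ℕ.< simplicial 5 (e ℕ.+ 40)
triangle-growth = triangle<simplicial₅ 1200 (ℕₚ.≤ᵇ⇒≤ 1200 (simplicial 3 41) _) (ℕₚ.≤ᵇ⇒≤ (1200 ℕ.* 45) (simplicial 4 41) _)
                    (ℕₚ.<ᵇ⇒< (1200 ℕ.* triangle 44) (simplicial 5 40) _)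

-- Arithmetic in an ordered field

module OrderedField (R : RealField) where
  open RealField R

  commutativeRing : CommutativeRing _ _
  commutativeRing = record { isCommutativeRing = isCommutativeRing }

  open CommutativeRing commutativeRing public
    using (+-identityˡ; +-identityʳ; *-identityˡ; *-identityʳ; +-assoc; +-comm; *-assoc; *-comm; zeroˡ; zeroʳ;
           distribˡ; distribʳ; -‿inverseˡ; -‿inverseʳ; commutativeSemiring)
  open SemiringSolver commutativeSemiring public using (solve; con; _:+_; _:*_; _:=_)

  open IsStrictTotalOrder isStrictTotalOrder public
    using (compare) renaming (trans to <-trans; irrefl to <-irrefl; isStrictPartialOrder to <-isStrictPartialOrder)

  <-strictPartialOrder : StrictPartialOrder _ _ _
  <-strictPartialOrder = record { isStrictPartialOrder = <-isStrictPartialOrder }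

  module ≤-Reasoning = StrictReasoning <-strictPartialOrder
  open ≤-Reasoning

  ≤-refl : ∀ {x} → x ≤ x
  ≤-refl = inj₂ refl

  ≤-reflexive : ∀ {x y} → x ≡ y → x ≤ y
  ≤-reflexive = inj₂

  ≤-trans : ∀ {x y z} → x ≤ y → y ≤ z → x ≤ z
  ≤-trans (inj₁ p)    (inj₁ q)    = inj₁ (<-trans p q)
  ≤-trans p           (inj₂ refl) = p
  ≤-trans (inj₂ refl) (inj₁ q)    = inj₁ q

  ≤-<-trans : ∀ {x y z} → x ≤ y → y < z → x < z
  ≤-<-trans (inj₁ p)    q = <-trans p q
  ≤-<-trans (inj₂ refl) q = q

  <-≤-trans : ∀ {x y z} → x < y → y ≤ z → x < z
  <-≤-trans p (inj₁ q)    = <-trans p q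
  <-≤-trans p (inj₂ refl) = p

  +-monoˡ-≤ : ∀ {x y} z → x ≤ y → x + z ≤ y + z
  +-monoˡ-≤ z (inj₁ p) = inj₁ (+-mono-< z p)
  +-monoˡ-≤ z (inj₂ e) = inj₂ (cong (_+ z) e)

  +-monoʳ-< : ∀ {x y} z → x < y → z + x < z + y
  +-monoʳ-< {x} {y} z p = begin-strict
    z + x ≡⟨ +-comm z x ⟩
    x + z <⟨ +-mono-< z p ⟩
    y + z ≡⟨ +-comm y z ⟩
    z + y ∎

  +-monoʳ-≤ : ∀ {x y} z → x ≤ y → z + x ≤ z + y
  +-monoʳ-≤ z (inj₁ p) = inj₁ (+-monoʳ-< z p)
  +-monoʳ-≤ z (inj₂ e) = inj₂ (cong (z +_) e)

  +-mono-≤ : ∀ {w x y z} → w ≤ x → y ≤ z → w + y ≤ x + z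
  +-mono-≤ {x = x} {y = y} p q = ≤-trans (+-monoˡ-≤ y p) (+-monoʳ-≤ x q)

  x<y⇒0<y-x : ∀ {x y} → x < y → 0# < y - x
  x<y⇒0<y-x {x} {y} p = begin-strict
    0#      ≡⟨ -‿inverseʳ x ⟨
    x - x   <⟨ +-mono-< (- x) p ⟩
    y - x   ∎

  x-y+y≡x : ∀ x y → x - y + y ≡ x
  x-y+y≡x x y = trans (+-assoc x (- y) y) (trans (cong (x +_) (-‿inverseˡ y)) (+-identityʳ x))

  *-monoʳ-< : ∀ {x y z} → 0# < z → x < y → z * x < z * y
  *-monoʳ-< {x} {y} {z} 0<z x<y = begin-strict
    z * x                      ≡⟨ +-identityˡ (z * x) ⟨
    0# + z * x                 <⟨ +-mono-< (z * x) (*-pos 0<z (x<y⇒0<y-x x<y)) ⟩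
    z * (y - x) + z * x        ≡⟨ distribˡ z (y - x) x ⟨
    z * (y - x + x)            ≡⟨ cong (z *_) (x-y+y≡x y x) ⟩
    z * y                      ∎

  *-monoʳ-≤ : ∀ {x y z} → 0# ≤ z → x ≤ y → z * x ≤ z * y
  *-monoʳ-≤ (inj₁ 0<z)  (inj₁ x<y)  = inj₁ (*-monoʳ-< 0<z x<y)
  *-monoʳ-≤ {x} {y} (inj₂ refl) _   = inj₂ (trans (zeroˡ x) (sym (zeroˡ y)))
  *-monoʳ-≤ _           (inj₂ refl) = ≤-refl

  *-monoˡ-≤ : ∀ {x y z} → 0# ≤ z → x ≤ y → x * z ≤ y * z
  *-monoˡ-≤ {x} {y} {z} 0≤z x≤y = begin
    x * z ≡⟨ *-comm x z ⟩
    z * x ≤⟨ *-monoʳ-≤ 0≤z x≤y ⟩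
    z * y ≡⟨ *-comm z y ⟩
    y * z ∎

  *-cancelˡ-≤ : ∀ {x y z} → 0# < z → z * x ≤ z * y → x ≤ y
  *-cancelˡ-≤ {x} {y} 0<z p with compare x y
  ... | tri< x<y _ _ = inj₁ x<y
  ... | tri≈ _ x≡y _ = inj₂ x≡y
  ... | tri> _ _ y<x = ⊥-elim (<-irrefl refl (<-≤-trans (*-monoʳ-< 0<z y<x) p))

  *-cancelˡ-< : ∀ {x y z} → 0# < z → z * x < z * y → x < y
  *-cancelˡ-< {x} {y} 0<z p with compare x y
  ... | tri< x<y _ _  = x<y
  ... | tri≈ _ refl _ = ⊥-elim (<-irrefl refl p)
  ... | tri> _ _ y<x  = ⊥-elim (<-irrefl refl (<-trans (*-monoʳ-< 0<z y<x) p))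

  +-nonneg : ∀ {x y} → 0# ≤ x → 0# ≤ y → 0# ≤ x + y
  +-nonneg p q = ≤-trans (≤-reflexive (sym (+-identityˡ 0#))) (+-mono-≤ p q)

  *-nonneg : ∀ {x y} → 0# ≤ x → 0# ≤ y → 0# ≤ x * y
  *-nonneg {x} p q = ≤-trans (≤-reflexive (sym (zeroʳ x))) (*-monoʳ-≤ p q)

  x≤x+y : ∀ {x y} → 0# ≤ y → x ≤ x + y
  x≤x+y {x} p = ≤-trans (≤-reflexive (sym (+-identityʳ x))) (+-monoʳ-≤ x p)

  -- If 1 < 0 then 0 < -1, whence -1 = -1 · 1 < -1 · 0 = 0.
  0<1 : 0# < 1#
  0<1 with compare 0# 1#
  ... | tri< p _ _ = p
  ... | tri≈ _ e _ = ⊥-elim (0≢1 e)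
  ... | tri> _ _ p = ⊥-elim (<-irrefl refl (<-trans 0<-1 (begin-strict
      - 1#               ≡⟨ *-identityʳ (- 1#) ⟨
      - 1# * 1#          <⟨ *-monoʳ-< 0<-1 p ⟩
      - 1# * 0#          ≡⟨ zeroʳ (- 1#) ⟩
      0#                 ∎)))
    where
    0<-1 : 0# < - 1#
    0<-1 = subst (0# <_) (+-identityˡ (- 1#)) (x<y⇒0<y-x p)


  fromℕ-+ : ∀ m n → fromℕ R (m ℕ.+ n) ≡ fromℕ R m + fromℕ R n
  fromℕ-+ zero    n = sym (+-identityˡ _)
  fromℕ-+ (suc m) n = trans (cong (1# +_) (fromℕ-+ m n)) (sym (+-assoc 1# _ _))

  fromℕ-* : ∀ m n → fromℕ R (m ℕ.* n) ≡ fromℕ R m * fromℕ R n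
  fromℕ-* zero    n = sym (zeroˡ _)
  fromℕ-* (suc m) n = begin-equality
    fromℕ R (n ℕ.+ m ℕ.* n)                 ≡⟨ fromℕ-+ n (m ℕ.* n) ⟩
    fromℕ R n + fromℕ R (m ℕ.* n)           ≡⟨ cong (fromℕ R n +_) (fromℕ-* m n) ⟩
    fromℕ R n + fromℕ R m * fromℕ R n       ≡⟨ solve 2 (λ m n → n :+ m :* n := (con 1 :+ m) :* n) refl (fromℕ R m) (fromℕ R n) ⟩
    (1# + fromℕ R m) * fromℕ R n            ∎

  0≤fromℕ : ∀ n → 0# ≤ fromℕ R n
  0≤fromℕ zero    = ≤-refl
  0≤fromℕ (suc n) = +-nonneg (inj₁ 0<1) (0≤fromℕ n)

  0<fromℕ-suc : ∀ n → 0# < fromℕ R (suc n)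
  0<fromℕ-suc n = <-≤-trans 0<1 (x≤x+y (0≤fromℕ n))

  fromℕ-mono-≤ : ∀ {m n} → m ℕ.≤ n → fromℕ R m ≤ fromℕ R n
  fromℕ-mono-≤ {n = n} z≤n = 0≤fromℕ n
  fromℕ-mono-≤ (s≤s m≤n) = +-monoʳ-≤ 1# (fromℕ-mono-≤ m≤n)

  fromℕ-mono-< : ∀ {m n} → m ℕ.< n → fromℕ R m < fromℕ R n
  fromℕ-mono-< {m} {n} m<n = <-≤-trans
    (subst (_< fromℕ R (suc m)) (+-identityˡ (fromℕ R m)) (+-mono-< (fromℕ R m) 0<1)) (fromℕ-mono-≤ m<n)

  0<⇒≢0 : ∀ {x} → 0# < x → ¬ (x ≡ 0#)
  0<⇒≢0 0<x refl = <-irrefl refl 0<x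

  factorial-pos : ∀ n → 0# < factorial R n
  factorial-pos zero    = 0<1
  factorial-pos (suc n) = *-pos (0<fromℕ-suc n) (factorial-pos n)

-- The ring of formal power series and its derivation

module CauchyProduct (R : RealField) where
  open RealField R
  open OrderedField R
  open ≡-Reasoning

  infixl 7 _⋆_
  _⋆_ : Series R → Series R → Series R
  _⋆_ = mulS R

  sumTo-cong : ∀ {f g : Series R} n → (∀ i → i ℕ.≤ n → f i ≡ g i) → sumTo R f n ≡ sumTo R g n
  sumTo-cong zero    f≡g = f≡g 0 z≤n
  sumTo-cong (suc n) f≡g = cong₂ _+_ (sumTo-cong n (λ i i≤n → f≡g i (ℕₚ.m≤n⇒m≤1+n i≤n))) (f≡g (suc n) ℕₚ.≤-refl)

  sumTo-zero : ∀ {f : Series R} n → (∀ i → i ℕ.≤ n → f i ≡ 0#) → sumTo R f n ≡ 0#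
  sumTo-zero zero    f≡0 = f≡0 0 z≤n
  sumTo-zero (suc n) f≡0 = trans
    (cong₂ _+_ (sumTo-zero n (λ i i≤n → f≡0 i (ℕₚ.m≤n⇒m≤1+n i≤n))) (f≡0 (suc n) ℕₚ.≤-refl)) (+-identityˡ 0#)

  sumTo-single : ∀ {f : Series R} n i → i ℕ.≤ n → (∀ j → ¬ j ≡ i → f j ≡ 0#) → sumTo R f n ≡ f i
  sumTo-single zero zero z≤n f≡0 = refl
  sumTo-single {f} (suc n) i i≤1+n f≡0 with i ℕₚ.≟ suc n
  ... | yes refl = trans (cong (_+ f (suc n)) (sumTo-zero n (λ j j≤n → f≡0 j (ℕₚ.<⇒≢ (s≤s j≤n))))) (+-identityˡ _)
  ... | no i≢1+n = trans
    (cong₂ _+_ (sumTo-single n i (s≤s⁻¹ (ℕₚ.≤∧≢⇒< i≤1+n i≢1+n)) f≡0) (f≡0 (suc n) (i≢1+n ∘ sym))) (+-identityʳ _)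

  sumTo-head : ∀ (f : Series R) n → sumTo R f (suc n) ≡ f 0 + sumTo R (f ∘ suc) n
  sumTo-head f zero    = refl
  sumTo-head f (suc n) = trans (cong (_+ f (suc (suc n))) (sumTo-head f n)) (+-assoc _ _ _)

  -- Stripping the head of the first factor avoids the truncated subtraction in the Cauchy product.
  -- The ring laws and the Leibniz rule are inductions along this identity.
  ⋆-head : ∀ f g n → (f ⋆ g) (suc n) ≡ f 0 * g (suc n) + ((f ∘ suc) ⋆ g) n
  ⋆-head f g n = sumTo-head _ n

  ⋆-tail : ∀ f g n → (f ⋆ g) (suc n) ≡ (f ⋆ (g ∘ suc)) n + f (suc n) * g 0
  ⋆-tail f g n = cong₂ _+_
    (sumTo-cong n (λ i i≤n → cong (λ j → f i * g j) (ℕₚ.+-∸-assoc 1 i≤n)))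
    (cong (λ j → f (suc n) * g j) (ℕₚ.n∸n≡0 n))

  ⋆-cong-≤ : ∀ {f f′ g g′ : Series R} n → (∀ i → i ℕ.≤ n → f i ≡ f′ i) → (∀ i → i ℕ.≤ n → g i ≡ g′ i) →
             (f ⋆ g) n ≡ (f′ ⋆ g′) n
  ⋆-cong-≤ n f≡f′ g≡g′ = sumTo-cong n (λ i i≤n → cong₂ _*_ (f≡f′ i i≤n) (g≡g′ (n ∸ i) (ℕₚ.m∸n≤m n i)))

  ⋆-congˡ : ∀ {f f′ : Series R} g n → f ≗ f′ → (f ⋆ g) n ≡ (f′ ⋆ g) n
  ⋆-congˡ g n f≡f′ = ⋆-cong-≤ {g = g} n (λ i _ → f≡f′ i) (λ _ _ → refl)

  ⋆-congʳ : ∀ f {g g′ : Series R} n → g ≗ g′ → (f ⋆ g) n ≡ (f ⋆ g′) n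
  ⋆-congʳ f {g} {g′} n g≡g′ = ⋆-cong-≤ {f = f} {g = g} {g′} n (λ _ _ → refl) (λ i _ → g≡g′ i)

  ⋆-vanishˡ : ∀ {f : Series R} g n → (∀ i → i ℕ.≤ n → f i ≡ 0#) → (f ⋆ g) n ≡ 0#
  ⋆-vanishˡ g n f≡0 = sumTo-zero n (λ i i≤n → trans (cong (_* g (n ∸ i)) (f≡0 i i≤n)) (zeroˡ _))

  ⋆-comm : ∀ f g n → (f ⋆ g) n ≡ (g ⋆ f) n
  ⋆-comm f g zero    = *-comm _ _
  ⋆-comm f g (suc n) = begin
    (f ⋆ g) (suc n)                               ≡⟨ ⋆-head f g n ⟩
    f 0 * g (suc n) + ((f ∘ suc) ⋆ g) n           ≡⟨ cong₂ _+_ (*-comm _ _) (⋆-comm (f ∘ suc) g n) ⟩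
    g (suc n) * f 0 + (g ⋆ (f ∘ suc)) n           ≡⟨ +-comm _ _ ⟩
    (g ⋆ (f ∘ suc)) n + g (suc n) * f 0           ≡⟨ ⋆-tail g f n ⟨
    (g ⋆ f) (suc n)                               ∎

  ⋆-distribʳ : ∀ (f f′ g : Series R) n → ((λ i → f i + f′ i) ⋆ g) n ≡ (f ⋆ g) n + (f′ ⋆ g) n
  ⋆-distribʳ f f′ g zero    = distribʳ _ _ _
  ⋆-distribʳ f f′ g (suc n) = begin
    ((λ i → f i + f′ i) ⋆ g) (suc n)
      ≡⟨ ⋆-head _ g n ⟩
    (f 0 + f′ 0) * g (suc n) + ((λ i → f (suc i) + f′ (suc i)) ⋆ g) n
      ≡⟨ cong ((f 0 + f′ 0) * g (suc n) +_) (⋆-distribʳ (f ∘ suc) (f′ ∘ suc) g n) ⟩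
    (f 0 + f′ 0) * g (suc n) + (((f ∘ suc) ⋆ g) n + ((f′ ∘ suc) ⋆ g) n)
      ≡⟨ solve 5 (λ a b c x y → (a :+ b) :* c :+ (x :+ y) := (a :* c :+ x) :+ (b :* c :+ y)) refl _ _ _ _ _ ⟩
    (f 0 * g (suc n) + ((f ∘ suc) ⋆ g) n) + (f′ 0 * g (suc n) + ((f′ ∘ suc) ⋆ g) n)
      ≡⟨ cong₂ _+_ (⋆-head f g n) (⋆-head f′ g n) ⟨
    (f ⋆ g) (suc n) + (f′ ⋆ g) (suc n) ∎

  ⋆-scaleˡ : ∀ c (f g : Series R) n → ((λ i → c * f i) ⋆ g) n ≡ c * (f ⋆ g) n
  ⋆-scaleˡ c f g zero    = *-assoc _ _ _
  ⋆-scaleˡ c f g (suc n) = begin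
    ((λ i → c * f i) ⋆ g) (suc n)                                 ≡⟨ ⋆-head _ g n ⟩
    c * f 0 * g (suc n) + ((λ i → c * f (suc i)) ⋆ g) n           ≡⟨ cong₂ _+_ (*-assoc _ _ _) (⋆-scaleˡ c (f ∘ suc) g n) ⟩
    c * (f 0 * g (suc n)) + c * ((f ∘ suc) ⋆ g) n                 ≡⟨ distribˡ _ _ _ ⟨
    c * (f 0 * g (suc n) + ((f ∘ suc) ⋆ g) n)                     ≡⟨ cong (c *_) (⋆-head f g n) ⟨
    c * (f ⋆ g) (suc n)                                           ∎

  ⋆-assoc : ∀ f g h n → ((f ⋆ g) ⋆ h) n ≡ (f ⋆ (g ⋆ h)) n
  ⋆-assoc f g h zero    = *-assoc _ _ _
  ⋆-assoc f g h (suc n) = begin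
    ((f ⋆ g) ⋆ h) (suc n)
      ≡⟨ ⋆-head (f ⋆ g) h n ⟩
    f 0 * g 0 * h (suc n) + (((f ⋆ g) ∘ suc) ⋆ h) n
      ≡⟨ cong (f 0 * g 0 * h (suc n) +_) (⋆-congˡ h n (⋆-head f g)) ⟩
    f 0 * g 0 * h (suc n) + ((λ i → f 0 * g (suc i) + ((f ∘ suc) ⋆ g) i) ⋆ h) n
      ≡⟨ cong (f 0 * g 0 * h (suc n) +_) (⋆-distribʳ (λ i → f 0 * g (suc i)) ((f ∘ suc) ⋆ g) h n) ⟩
    f 0 * g 0 * h (suc n) + (((λ i → f 0 * g (suc i)) ⋆ h) n + (((f ∘ suc) ⋆ g) ⋆ h) n)
      ≡⟨ cong (f 0 * g 0 * h (suc n) +_) (cong₂ _+_ (⋆-scaleˡ (f 0) (g ∘ suc) h n) (⋆-assoc (f ∘ suc) g h n)) ⟩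
    f 0 * g 0 * h (suc n) + (f 0 * ((g ∘ suc) ⋆ h) n + ((f ∘ suc) ⋆ (g ⋆ h)) n)
      ≡⟨ solve 5 (λ a b c x y → a :* b :* c :+ (a :* x :+ y) := a :* (b :* c :+ x) :+ y) refl _ _ _ _ _ ⟩
    f 0 * (g 0 * h (suc n) + ((g ∘ suc) ⋆ h) n) + ((f ∘ suc) ⋆ (g ⋆ h)) n
      ≡⟨ cong (λ u → f 0 * u + ((f ∘ suc) ⋆ (g ⋆ h)) n) (⋆-head g h n) ⟨
    f 0 * (g ⋆ h) (suc n) + ((f ∘ suc) ⋆ (g ⋆ h)) n
      ≡⟨ ⋆-head f (g ⋆ h) n ⟨
    (f ⋆ (g ⋆ h)) (suc n) ∎

  -- The derivation q d/dq.
  θ : Series R → Series R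
  θ f n = fromℕ R n * f n

  θ-⋆ : ∀ f g n → θ (f ⋆ g) n ≡ (θ f ⋆ g) n + (f ⋆ θ g) n
  θ-⋆ f g zero    = solve 2 (λ a b → con 0 :* (a :* b) := con 0 :* a :* b :+ a :* (con 0 :* b)) refl (f 0) (g 0)
  θ-⋆ f g (suc n) = begin
    N * (f ⋆ g) (suc n)
      ≡⟨ cong (N *_) (⋆-head f g n) ⟩
    N * (f 0 * g (suc n) + (f′ ⋆ g) n)
      ≡⟨ solve 4 (λ m a b x → (con 1 :+ m) :* (a :* b :+ x) := (con 1 :+ m) :* (a :* b) :+ (x :+ m :* x)) refl (fromℕ R n) (f 0) (g (suc n)) ((f′ ⋆ g) n) ⟩
    N * (f 0 * g (suc n)) + ((f′ ⋆ g) n + θ (f′ ⋆ g) n)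
      ≡⟨ cong (λ u → N * (f 0 * g (suc n)) + ((f′ ⋆ g) n + u)) (θ-⋆ f′ g n) ⟩
    N * (f 0 * g (suc n)) + ((f′ ⋆ g) n + ((θ f′ ⋆ g) n + (f′ ⋆ θ g) n))
      ≡⟨ solve 6 (λ m a b x y z → m :* (a :* b) :+ (x :+ (y :+ z)) := (con 0 :* a :* b :+ (x :+ y)) :+ (a :* (m :* b) :+ z)) refl N (f 0) (g (suc n)) _ _ _ ⟩
    (0# * f 0 * g (suc n) + ((f′ ⋆ g) n + (θ f′ ⋆ g) n)) + (f 0 * θ g (suc n) + (f′ ⋆ θ g) n)
      ≡⟨ cong₂ (λ u v → (0# * f 0 * g (suc n) + u) + v) (⋆-distribʳ f′ (θ f′) g n) (⋆-head f (θ g) n) ⟨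
    (0# * f 0 * g (suc n) + ((λ i → f′ i + θ f′ i) ⋆ g) n) + (f ⋆ θ g) (suc n)
      ≡⟨ cong (λ u → (0# * f 0 * g (suc n) + u) + (f ⋆ θ g) (suc n)) (⋆-congˡ g n θ-shift) ⟨
    (0# * f 0 * g (suc n) + ((θ f ∘ suc) ⋆ g) n) + (f ⋆ θ g) (suc n)
      ≡⟨ cong (_+ (f ⋆ θ g) (suc n)) (⋆-head (θ f) g n) ⟨
    (θ f ⋆ g) (suc n) + (f ⋆ θ g) (suc n) ∎
    where
    N = fromℕ R (suc n)
    f′ = f ∘ suc
    -- The shift lowers every index by one, so that `θ` leaves one extra copy of `f′` behind.
    θ-shift : ∀ i → θ f (suc i) ≡ f′ i + θ f′ i
    θ-shift i = solve 2 (λ m a → (con 1 :+ m) :* a := a :+ m :* a) refl (fromℕ R i) (f′ i)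

  ⋆-shift : ∀ M (f g : Series R) n → (∀ i → i ℕ.< M → f i ≡ 0#) → (f ⋆ g) (M ℕ.+ n) ≡ ((λ i → f (M ℕ.+ i)) ⋆ g) n
  ⋆-shift zero    f g n f≡0 = refl
  ⋆-shift (suc M) f g n f≡0 = begin
    (f ⋆ g) (suc (M ℕ.+ n))                                ≡⟨ ⋆-head f g (M ℕ.+ n) ⟩
    f 0 * g (suc (M ℕ.+ n)) + ((f ∘ suc) ⋆ g) (M ℕ.+ n)    ≡⟨ cong₂ _+_ (trans (cong (_* _) (f≡0 0 (s≤s z≤n))) (zeroˡ _))
                                                                (⋆-shift M (f ∘ suc) g n (λ i i<M → f≡0 (suc i) (s≤s i<M))) ⟩
    0# + ((λ i → f (suc M ℕ.+ i)) ⋆ g) n                   ≡⟨ +-identityˡ _ ⟩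
    ((λ i → f (suc M ℕ.+ i)) ⋆ g) n                        ∎

  ⋆-oneS : ∀ c (g : Series R) n → ((λ i → c * oneS R i) ⋆ g) n ≡ c * g n
  ⋆-oneS c g zero    = cong (_* g 0) (*-identityʳ c)
  ⋆-oneS c g (suc n) = begin
    ((λ i → c * oneS R i) ⋆ g) (suc n)                        ≡⟨ ⋆-head (λ i → c * oneS R i) g n ⟩
    c * 1# * g (suc n) + ((λ i → c * 0#) ⋆ g) n               ≡⟨ cong₂ _+_ (cong (_* _) (*-identityʳ c)) (⋆-vanishˡ g n (λ _ _ → zeroʳ c)) ⟩
    c * g (suc n) + 0#                                        ≡⟨ +-identityʳ _ ⟩
    c * g (suc n)                                             ∎

-- Logarithmic derivative of the Euler product and the recurrence for P_n

module EulerFactor (R : RealField) (z : RealField.Carrier R) where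
  open RealField R
  open OrderedField R
  open CauchyProduct R
  open ≡-Reasoning

  *-⁻¹ : ∀ {a b} → 0# < a → 0# < b → a * ((a * b) ⁻¹) ≡ b ⁻¹
  *-⁻¹ {a} {b} 0<a 0<b = begin
    a * (a * b) ⁻¹                    ≡⟨ *-identityʳ _ ⟨
    a * (a * b) ⁻¹ * 1#               ≡⟨ cong (a * (a * b) ⁻¹ *_) (⁻¹-inverse b (0<⇒≢0 0<b)) ⟨
    a * (a * b) ⁻¹ * (b * b ⁻¹)       ≡⟨ solve 4 (λ a b c d → a :* c :* (b :* d) := a :* b :* c :* d) refl a b _ _ ⟩
    a * b * (a * b) ⁻¹ * b ⁻¹         ≡⟨ cong (_* b ⁻¹) (⁻¹-inverse (a * b) (0<⇒≢0 (*-pos 0<a 0<b))) ⟩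
    1# * b ⁻¹                         ≡⟨ *-identityˡ _ ⟩
    b ⁻¹                              ∎

  negBinom-zero : negBinom R z 0 ≡ 1#
  negBinom-zero = ⁻¹-inverse 1# (0<⇒≢0 0<1)

  negBinom-suc : ∀ q → fromℕ R (suc q) * negBinom R z (suc q) ≡ (z + fromℕ R q) * negBinom R z q
  negBinom-suc q = begin
    n * (rising R z q * (z + fromℕ R q) * (n * factorial R q) ⁻¹)
      ≡⟨ solve 4 (λ n r w i → n :* (r :* w :* i) := w :* (r :* (n :* i))) refl n (rising R z q) (z + fromℕ R q) ((n * factorial R q) ⁻¹) ⟩
    (z + fromℕ R q) * (rising R z q * (n * (n * factorial R q) ⁻¹))
      ≡⟨ cong (λ i → (z + fromℕ R q) * (rising R z q * i)) (*-⁻¹ (0<fromℕ-suc q) (factorial-pos q)) ⟩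
    (z + fromℕ R q) * negBinom R z q ∎
    where n = fromℕ R (suc q)

  if-≡ : ∀ {m n} {x y : Carrier} → m ≡ n → (if m ≡ᵇ n then x else y) ≡ x
  if-≡ {zero}  refl = refl
  if-≡ {suc m} refl = if-≡ {m} refl

  if-≢ : ∀ m n {x y : Carrier} → ¬ m ≡ n → (if m ≡ᵇ n then x else y) ≡ y
  if-≢ m n m≢n with m ≡ᵇ n in eq
  ... | true  = ⊥-elim (m≢n (ℕₚ.≡ᵇ⇒≡ m n (subst T (sym eq) _)))
  ... | false = refl

  module _ (m : ℕ) where

    F : Series R
    F = factorS R z (suc m)

    F-multiple : ∀ q → F (suc m ℕ.* q) ≡ negBinom R z q
    F-multiple q = trans
      (sumTo-single (suc m ℕ.* q) q (ℕₚ.m≤n*m q (suc m))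
        (λ j j≢q → if-≢ (suc m ℕ.* j) (suc m ℕ.* q) (j≢q ∘ ℕₚ.*-cancelˡ-≡ j q (suc m))))
      (if-≡ {suc m ℕ.* q} refl)

    F-nonmultiple : ∀ k → ¬ (suc m ∣ k) → F k ≡ 0#
    F-nonmultiple k ∤k = sumTo-zero k (λ j _ → if-≢ (suc m ℕ.* j) k
      (λ e → ∤k (divides j (trans (sym e) (ℕₚ.*-comm (suc m) j)))))

    F-zero : F 0 ≡ 1#
    F-zero = trans (cong F (sym (ℕₚ.*-zeroʳ (suc m)))) (trans (F-multiple 0) negBinom-zero)

    F-small : ∀ k → suc k ℕ.≤ m → F (suc k) ≡ 0#
    F-small k k<m = F-nonmultiple (suc k) (λ ∣k → ℕₚ.<⇒≱ (s≤s k<m) (∣⇒≤ ∣k))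

    -- With M = m + 1 this is (1 - q^M) θF = z M q^M F, read on coefficients. Off the multiples of M
    -- both coefficients vanish; on them it is M times the recursion of `negBinom`.
    F-period : ∀ i → fromℕ R (suc m ℕ.+ i) * F (suc m ℕ.+ i) ≡ (fromℕ R i + z * fromℕ R (suc m)) * F i
    F-period i with suc m ∣? i
    ... | no ∤i = begin
      fromℕ R (suc m ℕ.+ i) * F (suc m ℕ.+ i)  ≡⟨ cong (fromℕ R (suc m ℕ.+ i) *_) (F-nonmultiple _ (λ ∣i → ∤i (∣m+n∣m⇒∣n ∣i ∣-refl))) ⟩
      fromℕ R (suc m ℕ.+ i) * 0#               ≡⟨ zeroʳ _ ⟩
      0#                                       ≡⟨ zeroʳ _ ⟨
      (fromℕ R i + z * fromℕ R (suc m)) * 0#   ≡⟨ cong ((fromℕ R i + z * fromℕ R (suc m)) *_) (F-nonmultiple i ∤i) ⟨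
      (fromℕ R i + z * fromℕ R (suc m)) * F i  ∎
    ... | yes (divides q refl) = begin
      fromℕ R (suc q ℕ.* suc m) * F (suc q ℕ.* suc m)
        ≡⟨ cong₂ _*_ (fromℕ-* (suc q) (suc m)) (trans (cong F (ℕₚ.*-comm (suc q) (suc m))) (F-multiple (suc q))) ⟩
      fromℕ R (suc q) * fromℕ R (suc m) * negBinom R z (suc q)
        ≡⟨ solve 3 (λ a b c → a :* b :* c := b :* (a :* c)) refl _ _ _ ⟩
      fromℕ R (suc m) * (fromℕ R (suc q) * negBinom R z (suc q))
        ≡⟨ cong (fromℕ R (suc m) *_) (negBinom-suc q) ⟩
      fromℕ R (suc m) * ((z + fromℕ R q) * negBinom R z q)
        ≡⟨ solve 4 (λ a b c d → a :* ((b :+ c) :* d) := (c :* a :+ b :* a) :* d) refl (fromℕ R (suc m)) z (fromℕ R q) (negBinom R z q) ⟩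
      (fromℕ R q * fromℕ R (suc m) + z * fromℕ R (suc m)) * negBinom R z q
        ≡⟨ cong₂ (λ u v → (u + z * fromℕ R (suc m)) * v) (fromℕ-* q (suc m)) (trans (cong F (ℕₚ.*-comm q (suc m))) (F-multiple q)) ⟨
      (fromℕ R (q ℕ.* suc m) + z * fromℕ R (suc m)) * F (q ℕ.* suc m) ∎

    -- Coefficients of the series m q^m / (1 - q^m), with m + 1 in place of m.
    ℓ : Series R
    ℓ k = fromℕ R (divTerm m k)

    -- With M = m + 1 this is (1 - q^M) ℓ = M q^M; the summand with `oneS` makes up for `ℓ 0` being
    -- 0 while `ℓ M` is M.
    ℓ-period : ∀ i → ℓ (suc m ℕ.+ i) ≡ ℓ i + fromℕ R (suc m) * oneS R i
    ℓ-period zero = begin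
      ℓ (suc m ℕ.+ 0)                  ≡⟨ cong ℓ (ℕₚ.+-identityʳ (suc m)) ⟩
      ℓ (suc m)                        ≡⟨ cong (fromℕ R) (divTerm-self m) ⟩
      fromℕ R (suc m)                  ≡⟨ solve 1 (λ a → a := con 0 :+ a :* con 1) refl _ ⟩
      0# + fromℕ R (suc m) * 1#        ∎
    ℓ-period (suc i) = begin
      ℓ (suc m ℕ.+ suc i)              ≡⟨ cong (fromℕ R) (divTerm-period m i) ⟩
      ℓ (suc i)                        ≡⟨ solve 2 (λ a b → a := a :+ b :* con 0) refl _ (fromℕ R (suc m)) ⟩
      ℓ (suc i) + fromℕ R (suc m) * 0# ∎

    ℓ-small : ∀ i → i ℕ.≤ m → ℓ i ≡ 0#
    ℓ-small i i≤m = cong (fromℕ R) (divTerm-small m i i≤m)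

    ℓ⋆F-period : ∀ i → (ℓ ⋆ F) (suc m ℕ.+ i) ≡ (ℓ ⋆ F) i + fromℕ R (suc m) * F i
    ℓ⋆F-period i = begin
      (ℓ ⋆ F) (suc m ℕ.+ i)                                      ≡⟨ ⋆-shift (suc m) ℓ F i (λ j j<m → ℓ-small j (s≤s⁻¹ j<m)) ⟩
      ((λ j → ℓ (suc m ℕ.+ j)) ⋆ F) i                            ≡⟨ ⋆-congˡ F i ℓ-period ⟩
      ((λ j → ℓ j + fromℕ R (suc m) * oneS R j) ⋆ F) i           ≡⟨ ⋆-distribʳ ℓ (λ j → fromℕ R (suc m) * oneS R j) F i ⟩
      (ℓ ⋆ F) i + ((λ j → fromℕ R (suc m) * oneS R j) ⋆ F) i     ≡⟨ cong ((ℓ ⋆ F) i +_) (⋆-oneS (fromℕ R (suc m)) F i) ⟩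
      (ℓ ⋆ F) i + fromℕ R (suc m) * F i                          ∎

    -- Both sides vanish below M = m + 1 and satisfy the same recurrence from i to M + i, so
    -- induction in steps of M takes the place of a division by 1 - q^M.
    factor-log-derivative : ∀ k → θ F k ≡ z * (ℓ ⋆ F) k
    factor-log-derivative = <-rec (λ k → θ F k ≡ z * (ℓ ⋆ F) k) step
      where
      θF-small : ∀ k → k ℕ.≤ m → θ F k ≡ 0#
      θF-small zero    _   = zeroˡ _
      θF-small (suc k) k<m = trans (cong (fromℕ R (suc k) *_) (F-small k k<m)) (zeroʳ _)
      step : ∀ k → (∀ {i} → i ℕ.< k → θ F i ≡ z * (ℓ ⋆ F) i) → θ F k ≡ z * (ℓ ⋆ F) k
      step k rec with k ℕₚ.≤? m
      ... | yes k≤m = begin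
        θ F k             ≡⟨ θF-small k k≤m ⟩
        0#                ≡⟨ zeroʳ z ⟨
        z * 0#            ≡⟨ cong (z *_) (⋆-vanishˡ F k (λ i i≤k → ℓ-small i (ℕₚ.≤-trans i≤k k≤m))) ⟨
        z * (ℓ ⋆ F) k     ∎
      ... | no k≰m with i , refl ← ℕₚ.m≤n⇒∃[o]m+o≡n (ℕₚ.≰⇒> k≰m) = begin
        θ F (suc m ℕ.+ i)                                         ≡⟨ F-period i ⟩
        (fromℕ R i + z * fromℕ R (suc m)) * F i                   ≡⟨ solve 4 (λ a z b f → (a :+ z :* b) :* f := a :* f :+ z :* (b :* f)) refl _ _ _ _ ⟩
        θ F i + z * (fromℕ R (suc m) * F i)                       ≡⟨ cong (_+ z * (fromℕ R (suc m) * F i)) (rec (s≤s (ℕₚ.m≤n+m i m))) ⟩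
        z * (ℓ ⋆ F) i + z * (fromℕ R (suc m) * F i)               ≡⟨ distribˡ z _ _ ⟨
        z * ((ℓ ⋆ F) i + fromℕ R (suc m) * F i)                   ≡⟨ cong (z *_) (ℓ⋆F-period i) ⟨
        z * (ℓ ⋆ F) (suc m ℕ.+ i)                                 ∎

  -- Logarithmic derivatives of the factors add up. The form θA = z D A, with `D` the partial
  -- divisor sum, avoids inverting the series A.
  product-log-derivative : ∀ N n → θ (prodS R z N) n ≡ z * ((λ k → fromℕ R (σ≤ N k)) ⋆ prodS R z N) n
  product-log-derivative zero n = begin
    θ (oneS R) n                        ≡⟨ θ-one n ⟩
    0#                                  ≡⟨ zeroʳ z ⟨
    z * 0#                              ≡⟨ cong (z *_) (⋆-vanishˡ (oneS R) n (λ _ _ → refl)) ⟨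
    z * ((λ _ → 0#) ⋆ oneS R) n         ∎
    where
    θ-one : ∀ n → θ (oneS R) n ≡ 0#
    θ-one zero    = zeroˡ _
    θ-one (suc n) = zeroʳ _
  product-log-derivative (suc N) n = begin
    θ (A ⋆ F N) n                                                       ≡⟨ θ-⋆ A (F N) n ⟩
    (θ A ⋆ F N) n + (A ⋆ θ (F N)) n                                     ≡⟨ cong₂ _+_ left right ⟩
    z * (D ⋆ (A ⋆ F N)) n + z * (ℓ N ⋆ (A ⋆ F N)) n                     ≡⟨ distribˡ z _ _ ⟨
    z * ((D ⋆ (A ⋆ F N)) n + (ℓ N ⋆ (A ⋆ F N)) n)                       ≡⟨ cong (z *_) (⋆-distribʳ D (ℓ N) (A ⋆ F N) n) ⟨
    z * ((λ k → D k + ℓ N k) ⋆ (A ⋆ F N)) n                             ≡⟨ cong (z *_) (⋆-congˡ (A ⋆ F N) n (λ k → fromℕ-+ (σ≤ N k) (divTerm N k))) ⟨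
    z * ((λ k → fromℕ R (σ≤ (suc N) k)) ⋆ (A ⋆ F N)) n                  ∎
    where
    A = prodS R z N
    D : Series R
    D k = fromℕ R (σ≤ N k)
    left : (θ A ⋆ F N) n ≡ z * (D ⋆ (A ⋆ F N)) n
    left = begin
      (θ A ⋆ F N) n                           ≡⟨ ⋆-congˡ (F N) n (product-log-derivative N) ⟩
      ((λ k → z * (D ⋆ A) k) ⋆ F N) n         ≡⟨ ⋆-scaleˡ z (D ⋆ A) (F N) n ⟩
      z * ((D ⋆ A) ⋆ F N) n                   ≡⟨ cong (z *_) (⋆-assoc D A (F N) n) ⟩
      z * (D ⋆ (A ⋆ F N)) n                   ∎
    right : (A ⋆ θ (F N)) n ≡ z * (ℓ N ⋆ (A ⋆ F N)) n
    right = begin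
      (A ⋆ θ (F N)) n                         ≡⟨ ⋆-comm A (θ (F N)) n ⟩
      (θ (F N) ⋆ A) n                         ≡⟨ ⋆-congˡ A n (factor-log-derivative N) ⟩
      ((λ k → z * (ℓ N ⋆ F N) k) ⋆ A) n       ≡⟨ ⋆-scaleˡ z (ℓ N ⋆ F N) A n ⟩
      z * ((ℓ N ⋆ F N) ⋆ A) n                 ≡⟨ cong (z *_) (⋆-assoc (ℓ N) (F N) A n) ⟩
      z * (ℓ N ⋆ (F N ⋆ A)) n                 ≡⟨ cong (z *_) (⋆-congʳ (ℓ N) n (⋆-comm (F N) A)) ⟩
      z * (ℓ N ⋆ (A ⋆ F N)) n                 ∎

  -- The new factor is 1 + O(q^(N+1)).
  prodS-suc : ∀ N k → k ℕ.≤ N → prodS R z (suc N) k ≡ prodS R z N k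
  prodS-suc N k k≤N = trans (⋆-comm (prodS R z N) (F N) k) (go k k≤N)
    where
    A = prodS R z N
    go : ∀ k → k ℕ.≤ N → (F N ⋆ A) k ≡ A k
    go zero    _   = trans (cong (_* A 0) (F-zero N)) (*-identityˡ _)
    go (suc k) k<N = begin
      (F N ⋆ A) (suc k)                                ≡⟨ ⋆-head (F N) A k ⟩
      F N 0 * A (suc k) + ((F N ∘ suc) ⋆ A) k          ≡⟨ cong₂ _+_ (cong (_* A (suc k)) (F-zero N))
                                                            (⋆-vanishˡ A k (λ i i≤k → F-small N i (ℕₚ.≤-trans (s≤s i≤k) k<N))) ⟩
      1# * A (suc k) + 0#                              ≡⟨ trans (+-identityʳ _) (*-identityˡ _) ⟩
      A (suc k)                                        ∎

  prodS-stable : ∀ {k N} → k ℕ.≤ N → prodS R z N k ≡ P R k z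
  prodS-stable {k} k≤N with d , refl ← ℕₚ.m≤n⇒∃[o]m+o≡n k≤N = go d
    where
    go : ∀ d → prodS R z (k ℕ.+ d) k ≡ P R k z
    go zero    = cong (λ N → prodS R z N k) (ℕₚ.+-identityʳ k)
    go (suc d) = begin
      prodS R z (k ℕ.+ suc d) k     ≡⟨ cong (λ N → prodS R z N k) (ℕₚ.+-suc k d) ⟩
      prodS R z (suc (k ℕ.+ d)) k   ≡⟨ prodS-suc (k ℕ.+ d) k (ℕₚ.m≤m+n k d) ⟩
      prodS R z (k ℕ.+ d) k         ≡⟨ go d ⟩
      P R k z                       ∎

  -- The sum over j ≤ n of σ(k + j) P_{n-j}. The case k = 1 is the sum in the recurrence for
  -- P_{n+1}; the free offset `k` allows inductions that remove the leading term.
  tail : ℕ → ℕ → Carrier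
  tail k zero    = fromℕ R (σ k) * P R 0 z
  tail k (suc n) = fromℕ R (σ k) * P R (suc n) z + tail (suc k) n

  tail≡⋆ : ∀ k n → tail k n ≡ ((λ j → fromℕ R (σ (k ℕ.+ j))) ⋆ (λ j → P R j z)) n
  tail≡⋆ k zero    = cong (λ j → fromℕ R (σ j) * P R 0 z) (sym (ℕₚ.+-identityʳ k))
  tail≡⋆ k (suc n) = begin
    fromℕ R (σ k) * P R (suc n) z + tail (suc k) n
      ≡⟨ cong₂ _+_ (cong (λ j → fromℕ R (σ j) * P R (suc n) z) (sym (ℕₚ.+-identityʳ k))) (tail≡⋆ (suc k) n) ⟩
    fromℕ R (σ (k ℕ.+ 0)) * P R (suc n) z + ((λ j → fromℕ R (σ (suc k ℕ.+ j))) ⋆ (λ j → P R j z)) n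
      ≡⟨ cong (fromℕ R (σ (k ℕ.+ 0)) * P R (suc n) z +_) (⋆-congˡ (λ j → P R j z) n (λ j → cong (fromℕ R ∘ σ) (ℕₚ.+-suc k j))) ⟨
    fromℕ R (σ (k ℕ.+ 0)) * P R (suc n) z + ((λ j → fromℕ R (σ (k ℕ.+ suc j))) ⋆ (λ j → P R j z)) n
      ≡⟨ ⋆-head (λ j → fromℕ R (σ (k ℕ.+ j))) (λ j → P R j z) n ⟨
    ((λ j → fromℕ R (σ (k ℕ.+ j))) ⋆ (λ j → P R j z)) (suc n) ∎

  P-recurrence : ∀ n → fromℕ R (suc n) * P R (suc n) z ≡ z * tail 1 n
  P-recurrence n = begin
    fromℕ R (suc n) * P R (suc n) z
      ≡⟨ product-log-derivative (suc n) (suc n) ⟩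
    z * ((λ k → fromℕ R (σ≤ (suc n) k)) ⋆ prodS R z (suc n)) (suc n)
      ≡⟨ cong (z *_) (⋆-cong-≤ {g = prodS R z (suc n)} {λ j → P R j z} (suc n) (λ k k≤n → cong (fromℕ R) (stable k k≤n)) (λ k k≤n → prodS-stable k≤n)) ⟩
    z * ((λ k → fromℕ R (σ k)) ⋆ (λ j → P R j z)) (suc n)
      ≡⟨ cong (z *_) (tail≡⋆ 0 (suc n)) ⟨
    -- `σ 0` is 0, so P_{n+1} drops out of its own recurrence.
    z * (0# * P R (suc n) z + tail 1 n)
      ≡⟨ cong (z *_) (trans (cong (_+ tail 1 n) (zeroˡ _)) (+-identityˡ _)) ⟩
    z * tail 1 n ∎
    where
    stable : ∀ k → k ℕ.≤ suc n → σ≤ (suc n) k ≡ σ k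
    stable k k≤n with d , e ← ℕₚ.m≤n⇒∃[o]m+o≡n k≤n =
      trans (cong (λ N → σ≤ N k) (trans (sym e) (ℕₚ.+-comm k d))) (σ≤-stable d k)

-- Polynomial certificates for the finitely many small indices

-- Polynomials with natural coefficients, constant term first.
Poly : Set
Poly = List ℕ

infixl 6 _⊕_
infixl 7 _⊗_ _·_
infix  4 _≼_

_⊕_ : Poly → Poly → Poly
[]      ⊕ q       = q
(a ∷ p) ⊕ []      = a ∷ p
(a ∷ p) ⊕ (b ∷ q) = a ℕ.+ b ∷ p ⊕ q

_·_ : ℕ → Poly → Poly
c · p = map (c ℕ.*_) p

_⊗_ : Poly → Poly → Poly
[]      ⊗ q = []
(a ∷ p) ⊗ q = a · q ⊕ (0 ∷ p ⊗ q)

_≼_ : Poly → Poly → Bool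
[]      ≼ q       = true
(a ∷ p) ≼ []      = (a ≡ᵇ 0) ∧ (p ≼ [])
(a ∷ p) ≼ (b ∷ q) = (a ≤ᵇ b) ∧ (p ≼ q)

-- On the history p_n , … , p_0 below this is Horner's scheme for n! Σ_j σ(k + j) p_{n-j} / (n-j)!.
weighted : ℕ → ℕ → List Poly → Poly
weighted k n []      = []
weighted k n (p ∷ h) = σ k · p ⊕ n · weighted (suc k) (n ∸ 1) h

extend : ℕ → ℕ → List Poly → List Poly
extend c n h = (c ∷ 1 ∷ []) ⊗ weighted 1 n h ∷ h

-- p_n , … , p_0, where p_n is the polynomial n! P_n(c + t) in t; extend shares its argument, which
-- keeps the evaluation polynomial.
hist : ℕ → ℕ → List Poly
hist c zero    = (1 ∷ []) ∷ []
hist c (suc n) = extend c n (hist c n)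

head₀ : List Poly → Poly
head₀ []      = []
head₀ (p ∷ _) = p

poly : ℕ → ℕ → Poly
poly c n = head₀ (hist c n)

-- The tails of a history are the earlier histories, so the checks for all indices run along one
-- list and every polynomial is computed only once.
descend : (ℕ → List Poly → Bool) → ℕ → List Poly → Bool
descend f zero    h = f 0 h
descend f (suc n) h = f (suc n) h ∧ descend f n (drop 1 h)

descend-sound : ∀ f c N → T (descend f N (hist c N)) → ∀ {m} → m ℕ.≤ N → T (f m (hist c m))
descend-sound f c zero    ok z≤n = ok
descend-sound f c (suc N) ok {m} m≤1+N with m ℕₚ.≟ suc N
... | yes refl = proj₁ (Equivalence.to T-∧ ok)
... | no m≢1+N = descend-sound f c N (proj₂ (Equivalence.to (T-∧ {f (suc N) (hist c (suc N))}) ok)) (s≤s⁻¹ (ℕₚ.≤∧≢⇒< m≤1+N m≢1+N))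

-- The summand t makes the inequality strict for t > 0.
ratioCheck : ℕ → Poly → Poly → ℕ → List Poly → Bool
ratioCheck b p q a h =
  (a ≤ᵇ suc b) ∨ (suc b · (head₀ h ⊗ p) ⊕ (0 ∷ 1 ∷ []) ≼ a · (head₀ (drop 1 h) ⊗ q))

-- 6 (P_0 + P_1 + P_2 + P_3)
sextuple : ℕ → Poly
sextuple c = 6 · poly c 0 ⊕ 6 · poly c 1 ⊕ 3 · poly c 2 ⊕ 1 · poly c 3

-- With m = s + 3 this is (s + 5 choose 5) Q ≤ 300 P_m, where Q = P_0 + P_1 + P_2 + P_3, multiplied
-- by 6 · 5! · m!; 1800 is 6 times 300. The constant 300 is nearly forced: at x = 1 and s = 18 the
-- partition numbers give 7 · 33649 / 792 > 297.
growthCheck : Poly → ℕ → List Poly → Bool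
growthCheck q m h = (m ≤ᵇ 2) ∨ ((m ! ℕ.* ascending (m ∸ 3) 5) · q ≼ 5 ! ℕ.* 1800 · head₀ h)

-- The index of the check is n + 1 in P_b P_{n+1} < P_{b+1} P_n, so 43 covers all n ≤ 42, the range
-- that precedes the growth argument.
ratioCheck₁ : T (descend (ratioCheck 1 (poly 1 1) (poly 1 2)) 43 (hist 1 43))
ratioCheck₁ = _

-- The expansion is at 2 because Δ_{4,2} is negative at x = 1, where it equals 9 - 10, and vanishes
-- at x = 2, where it equals 100 - 100. Constant terms can therefore tie, and strictness has to come
-- from the coefficient of t.
ratioCheck₂ : T (descend (ratioCheck 2 (poly 2 2) (poly 2 3)) 43 (hist 2 43))
ratioCheck₂ = _

ratioCheck₃ : T (descend (ratioCheck 3 (poly 1 3) (poly 1 4)) 43 (hist 1 43))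
ratioCheck₃ = _

growthCheck₁ : T (descend (growthCheck (sextuple 1)) 42 (hist 1 42))
growthCheck₁ = _

-- Ratio inequalities from the recurrence

module Monotonicity (R : RealField) (x : RealField.Carrier R) (0<x : RealField._<_ R (RealField.0# R) x) where
  open RealField R
  open OrderedField R
  open EulerFactor R x
  open ≤-Reasoning

  p : ℕ → Carrier
  p n = P R n x

  p-nonneg    : ∀ n → 0# ≤ p n
  tail-nonneg : ∀ k n → 0# ≤ tail k n
  p-nonneg zero    = inj₁ 0<1
  p-nonneg (suc n) = *-cancelˡ-≤ (0<fromℕ-suc n) (begin
    fromℕ R (suc n) * 0#         ≡⟨ zeroʳ _ ⟩
    0#                           ≤⟨ *-nonneg (inj₁ 0<x) (tail-nonneg 1 n) ⟩
    x * tail 1 n                 ≡⟨ P-recurrence n ⟨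
    fromℕ R (suc n) * p (suc n)  ∎)
  tail-nonneg k zero    = *-nonneg (0≤fromℕ (σ k)) (p-nonneg 0)
  tail-nonneg k (suc n) = +-nonneg (*-nonneg (0≤fromℕ (σ k)) (p-nonneg (suc n))) (tail-nonneg (suc k) n)

  tail-lower : ∀ k n → fromℕ R (σ k) * p n ≤ tail k n
  tail-lower k zero    = ≤-refl
  tail-lower k (suc n) = x≤x+y (tail-nonneg (suc k) n)

  -- Only the term with σ(1) = 1 of the recurrence is kept. This yields positivity, and later it
  -- trades `x * p b` for a multiple of `p (suc b)`.
  p-suc-lower : ∀ n → x * p n ≤ fromℕ R (suc n) * p (suc n)
  p-suc-lower n = begin
    x * p n                        ≡⟨ cong (x *_) (solve 1 (λ a → a := (con 1 :+ con 0) :* a) refl (p n)) ⟩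
    x * (fromℕ R (σ 1) * p n)      ≤⟨ *-monoʳ-≤ (inj₁ 0<x) (tail-lower 1 n) ⟩
    x * tail 1 n                   ≡⟨ P-recurrence n ⟨
    fromℕ R (suc n) * p (suc n)    ∎

  p-pos : ∀ n → 0# < p n
  p-pos zero    = 0<1
  p-pos (suc n) = *-cancelˡ-< (0<fromℕ-suc n) (begin-strict
    fromℕ R (suc n) * 0#           ≡⟨ zeroʳ _ ⟩
    0#                             <⟨ *-pos 0<x (p-pos n) ⟩
    x * p n                        ≤⟨ p-suc-lower n ⟩
    fromℕ R (suc n) * p (suc n)    ∎)

  sumTo-p-mono : ∀ {m n} → m ℕ.≤ n → sumTo R p m ≤ sumTo R p n
  sumTo-p-mono {m} m≤n with d , refl ← ℕₚ.m≤n⇒∃[o]m+o≡n m≤n = go d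
    where
    go : ∀ d → sumTo R p m ≤ sumTo R p (m ℕ.+ d)
    go zero    = ≤-reflexive (cong (sumTo R p) (sym (ℕₚ.+-identityʳ m)))
    go (suc d) = ≤-trans (go d) (≤-trans (x≤x+y (p-nonneg (suc (m ℕ.+ d)))) (≤-reflexive (cong (sumTo R p) (sym (ℕₚ.+-suc m d)))))

  tail-upper : ∀ N k n → k ℕ.+ n ℕ.≤ N → tail k n ≤ fromℕ R (triangle N) * sumTo R p n
  tail-upper N k zero k≤N = *-monoˡ-≤ (p-nonneg 0)
    (fromℕ-mono-≤ (σ-bound (ℕₚ.≤-trans (ℕₚ.≤-reflexive (sym (ℕₚ.+-identityʳ k))) k≤N)))
  tail-upper N k (suc n) k+n≤N = begin
    fromℕ R (σ k) * p (suc n) + tail (suc k) n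
      ≤⟨ +-mono-≤ (*-monoˡ-≤ (p-nonneg (suc n)) (fromℕ-mono-≤ (σ-bound (ℕₚ.≤-trans (ℕₚ.m≤m+n k (suc n)) k+n≤N))))
                  (tail-upper N (suc k) n (ℕₚ.≤-trans (ℕₚ.≤-reflexive (sym (ℕₚ.+-suc k n))) k+n≤N)) ⟩
    S * p (suc n) + S * sumTo R p n     ≡⟨ solve 3 (λ s a b → s :* a :+ s :* b := s :* (b :+ a)) refl S (p (suc n)) (sumTo R p n) ⟩
    S * (sumTo R p n + p (suc n))       ∎
    where S = fromℕ R (triangle N)

  -- Telescopes p_b p_{j+1} ≤ p_{b+1} p_j over j ≥ b; only the terms p_0, …, p_b remain uncompared.
  tail-compare : ∀ b N e k → k ℕ.+ suc (e ℕ.+ b) ℕ.≤ N →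
                 (∀ i → i ℕ.≤ e → p b * p (suc (i ℕ.+ b)) ≤ p (suc b) * p (i ℕ.+ b)) →
                 p b * tail k (suc (e ℕ.+ b)) ≤ p (suc b) * tail k (e ℕ.+ b) + p b * (fromℕ R (triangle N) * sumTo R p b)
  tail-compare b N zero k bound ratio = begin
    p b * (fromℕ R (σ k) * p (suc b) + tail (suc k) b)
      ≡⟨ solve 4 (λ a s c d → a :* (s :* c :+ d) := c :* (s :* a) :+ a :* d) refl (p b) (fromℕ R (σ k)) (p (suc b)) (tail (suc k) b) ⟩
    p (suc b) * (fromℕ R (σ k) * p b) + p b * tail (suc k) b
      ≤⟨ +-mono-≤ (*-monoʳ-≤ (p-nonneg (suc b)) (tail-lower k b))
                  (*-monoʳ-≤ (p-nonneg b) (tail-upper N (suc k) b (ℕₚ.≤-trans (ℕₚ.≤-reflexive (sym (ℕₚ.+-suc k b))) bound))) ⟩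
    p (suc b) * tail k b + p b * (fromℕ R (triangle N) * sumTo R p b) ∎
  tail-compare b N (suc e) k bound ratio = begin
    p b * (s * p (suc (suc e ℕ.+ b)) + tail (suc k) (suc (e ℕ.+ b)))
      ≡⟨ solve 4 (λ a s c d → a :* (s :* c :+ d) := s :* (a :* c) :+ a :* d) refl (p b) s _ _ ⟩
    s * (p b * p (suc (suc e ℕ.+ b))) + p b * tail (suc k) (suc (e ℕ.+ b))
      ≤⟨ +-mono-≤ (*-monoʳ-≤ (0≤fromℕ (σ k)) (ratio (suc e) ℕₚ.≤-refl))
                  (tail-compare b N e (suc k) (ℕₚ.≤-trans (ℕₚ.≤-reflexive (sym (ℕₚ.+-suc k _))) bound)
                    (λ i i≤e → ratio i (ℕₚ.m≤n⇒m≤1+n i≤e))) ⟩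
    s * (p (suc b) * p (suc e ℕ.+ b)) + (p (suc b) * tail (suc k) (e ℕ.+ b) + E)
      ≡⟨ solve 5 (λ s c a d e → s :* (c :* a) :+ (c :* d :+ e) := c :* (s :* a :+ d) :+ e) refl s (p (suc b)) _ _ E ⟩
    p (suc b) * (s * p (suc e ℕ.+ b) + tail (suc k) (e ℕ.+ b)) + E ∎
    where
    s = fromℕ R (σ k)
    E = p b * (fromℕ R (triangle N) * sumTo R p b)

  Q : Carrier
  Q = sumTo R p 3

  ratio-step : ∀ b e → b ℕ.≤ 3 →
               (∀ i → i ℕ.≤ e → p b * p (suc (i ℕ.+ b)) ≤ p (suc b) * p (i ℕ.+ b)) →
               fromℕ R 4 * (fromℕ R (triangle (suc (suc (e ℕ.+ b)))) * Q) < p (suc (e ℕ.+ b)) →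
               p b * p (suc (suc (e ℕ.+ b))) < p (suc b) * p (suc (e ℕ.+ b))
  ratio-step b e b≤3 ratio large = *-cancelˡ-< (0<fromℕ-suc (suc n)) (begin-strict
    fromℕ R (suc (suc n)) * (p b * p (suc (suc n)))
      ≡⟨ solve 3 (λ a c d → a :* (c :* d) := c :* (a :* d)) refl (fromℕ R (suc (suc n))) (p b) (p (suc (suc n))) ⟩
    p b * (fromℕ R (suc (suc n)) * p (suc (suc n)))
      ≡⟨ cong (p b *_) (P-recurrence (suc n)) ⟩
    p b * (x * tail 1 (suc n))
      ≡⟨ solve 3 (λ a c d → a :* (c :* d) := c :* (a :* d)) refl (p b) x (tail 1 (suc n)) ⟩
    x * (p b * tail 1 (suc n))
      ≤⟨ *-monoʳ-≤ (inj₁ 0<x) (tail-compare b (suc (suc n)) e 1 ℕₚ.≤-refl ratio) ⟩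
    x * (p (suc b) * tail 1 n + p b * (S * sumTo R p b))
      ≡⟨ solve 5 (λ x c t a q → x :* (c :* t :+ a :* q) := c :* (x :* t) :+ x :* a :* q) refl x (p (suc b)) (tail 1 n) (p b) (S * sumTo R p b) ⟩
    p (suc b) * (x * tail 1 n) + x * p b * (S * sumTo R p b)
      ≡⟨ cong (λ u → p (suc b) * u + x * p b * (S * sumTo R p b)) (P-recurrence n) ⟨
    p (suc b) * (fromℕ R (suc n) * p (suc n)) + x * p b * (S * sumTo R p b)
      ≤⟨ +-monoʳ-≤ _ (*-monoʳ-≤ (*-nonneg (inj₁ 0<x) (p-nonneg b)) (*-monoʳ-≤ (0≤fromℕ (triangle (suc (suc n)))) (sumTo-p-mono b≤3))) ⟩
    p (suc b) * (fromℕ R (suc n) * p (suc n)) + x * p b * (S * Q)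
      -- x P_b ≤ (b + 1) P_{b+1} ≤ 4 P_{b+1}: this is the origin of the 4, and it gives the error
      -- the same factor P_{b+1} as the surplus.
      ≤⟨ +-monoʳ-≤ _ (*-monoˡ-≤ SQ≥0 (≤-trans (p-suc-lower b) (*-monoˡ-≤ (p-nonneg (suc b)) (fromℕ-mono-≤ (s≤s b≤3))))) ⟩
    p (suc b) * (fromℕ R (suc n) * p (suc n)) + fromℕ R 4 * p (suc b) * (S * Q)
      ≡⟨ cong (p (suc b) * (fromℕ R (suc n) * p (suc n)) +_) (solve 3 (λ a b c → a :* b :* c := b :* (a :* c)) refl (fromℕ R 4) (p (suc b)) (S * Q)) ⟩
    p (suc b) * (fromℕ R (suc n) * p (suc n)) + p (suc b) * (fromℕ R 4 * (S * Q))
      <⟨ +-monoʳ-< _ (*-monoʳ-< (p-pos (suc b)) large) ⟩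
    p (suc b) * (fromℕ R (suc n) * p (suc n)) + p (suc b) * p (suc n)
      ≡⟨ solve 3 (λ c m a → c :* (m :* a) :+ c :* a := (con 1 :+ m) :* (c :* a)) refl (p (suc b)) (fromℕ R (suc n)) (p (suc n)) ⟩
    fromℕ R (suc (suc n)) * (p (suc b) * p (suc n)) ∎)
    where
    n = e ℕ.+ b
    S = fromℕ R (triangle (suc (suc n)))
    SQ≥0 : 0# ≤ S * Q
    SQ≥0 = *-nonneg (0≤fromℕ (triangle (suc (suc n)))) (≤-trans (p-nonneg 0) (sumTo-p-mono {0} {3} z≤n))

-- Soundness of the polynomial certificates

module Evaluation (R : RealField) (t : RealField.Carrier R) (0<t : RealField._<_ R (RealField.0# R) t) where
  open RealField R
  open OrderedField R
  open ≤-Reasoning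

  eval : Poly → Carrier
  eval []      = 0#
  eval (a ∷ p) = fromℕ R a + t * eval p

  eval-nonneg : ∀ p → 0# ≤ eval p
  eval-nonneg []      = ≤-refl
  eval-nonneg (a ∷ p) = +-nonneg (0≤fromℕ a) (*-nonneg (inj₁ 0<t) (eval-nonneg p))

  eval-⊕ : ∀ p q → eval (p ⊕ q) ≡ eval p + eval q
  eval-⊕ []      q       = sym (+-identityˡ _)
  eval-⊕ (a ∷ p) []      = sym (+-identityʳ _)
  eval-⊕ (a ∷ p) (b ∷ q) = begin-equality
    fromℕ R (a ℕ.+ b) + t * eval (p ⊕ q)              ≡⟨ cong₂ (λ u v → u + t * v) (fromℕ-+ a b) (eval-⊕ p q) ⟩
    fromℕ R a + fromℕ R b + t * (eval p + eval q)     ≡⟨ solve 5 (λ a b t p q → a :+ b :+ t :* (p :+ q) := a :+ t :* p :+ (b :+ t :* q)) refl _ _ _ _ _ ⟩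
    eval (a ∷ p) + eval (b ∷ q)                       ∎

  eval-· : ∀ c p → eval (c · p) ≡ fromℕ R c * eval p
  eval-· c []      = sym (zeroʳ _)
  eval-· c (a ∷ p) = begin-equality
    fromℕ R (c ℕ.* a) + t * eval (c · p)              ≡⟨ cong₂ (λ u v → u + t * v) (fromℕ-* c a) (eval-· c p) ⟩
    fromℕ R c * fromℕ R a + t * (fromℕ R c * eval p)  ≡⟨ solve 4 (λ c a t p → c :* a :+ t :* (c :* p) := c :* (a :+ t :* p)) refl _ _ _ _ ⟩
    fromℕ R c * eval (a ∷ p)                          ∎

  eval-⊗ : ∀ p q → eval (p ⊗ q) ≡ eval p * eval q
  eval-⊗ []      q = sym (zeroˡ _)
  eval-⊗ (a ∷ p) q = begin-equality
    eval (a · q ⊕ (0 ∷ p ⊗ q))                        ≡⟨ eval-⊕ (a · q) (0 ∷ p ⊗ q) ⟩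
    eval (a · q) + (0# + t * eval (p ⊗ q))            ≡⟨ cong₂ (λ u v → u + (0# + t * v)) (eval-· a q) (eval-⊗ p q) ⟩
    fromℕ R a * eval q + (0# + t * (eval p * eval q)) ≡⟨ solve 4 (λ a t p q → a :* q :+ (con 0 :+ t :* (p :* q)) := (a :+ t :* p) :* q) refl _ _ _ _ ⟩
    eval (a ∷ p) * eval q                             ∎

  eval-≼ : ∀ p q → T (p ≼ q) → eval p ≤ eval q
  eval-≼ []      q       _  = eval-nonneg q
  eval-≼ (a ∷ p) []      ok with a≡0 , p≼0 ← Equivalence.to (T-∧ {a ≡ᵇ 0}) ok = begin
    fromℕ R a + t * eval p   ≤⟨ +-mono-≤ (≤-reflexive (cong (fromℕ R) (ℕₚ.≡ᵇ⇒≡ a 0 a≡0))) (*-monoʳ-≤ (inj₁ 0<t) (eval-≼ p [] p≼0)) ⟩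
    0# + t * 0#              ≡⟨ solve 1 (λ t → con 0 :+ t :* con 0 := con 0) refl t ⟩
    0#                       ∎
  eval-≼ (a ∷ p) (b ∷ q) ok with a≤b , p≼q ← Equivalence.to (T-∧ {a ≤ᵇ b}) ok =
    +-mono-≤ (fromℕ-mono-≤ (ℕₚ.≤ᵇ⇒≤ a b a≤b)) (*-monoʳ-≤ (inj₁ 0<t) (eval-≼ p q p≼q))

  eval-t : eval (0 ∷ 1 ∷ []) ≡ t
  eval-t = solve 1 (λ t → con 0 :+ t :* (con 1 :+ con 0 :+ t :* con 0) := t) refl t

module Certificate (R : RealField) (c : ℕ) (x : RealField.Carrier R) (c<x : RealField._<_ R (fromℕ R c) x) where
  open RealField R
  open OrderedField R
  open EulerFactor R x
  open ≤-Reasoning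

  0<x : 0# < x
  0<x = ≤-<-trans (0≤fromℕ c) c<x

  open Monotonicity R x 0<x

  t : Carrier
  t = x - fromℕ R c

  0<t : 0# < t
  0<t = x<y⇒0<y-x c<x

  open Evaluation R t 0<t

  eval-x : eval (c ∷ 1 ∷ []) ≡ x
  eval-x = begin-equality
    fromℕ R c + t * (1# + 0# + t * 0#)    ≡⟨ solve 2 (λ c t → c :+ t :* (con 1 :+ con 0 :+ t :* con 0) := t :+ c) refl (fromℕ R c) t ⟩
    t + fromℕ R c                         ≡⟨ x-y+y≡x x (fromℕ R c) ⟩
    x                                     ∎

  -- Mutual induction along the recurrence: in `weighted` the factors n, n - 1, ... accumulate to n!
  -- / (n - j)!, which turns the weight (n - j)! of each earlier polynomial into the common weight
  -- n!.
  eval-poly     : ∀ n → eval (poly c n) ≡ factorial R n * p n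
  eval-weighted : ∀ n k → eval (weighted k n (hist c n)) ≡ factorial R n * tail k n
  eval-poly zero = solve 1 (λ t → con 1 :+ con 0 :+ t :* con 0 := con 1 :* con 1) refl t
  eval-poly (suc n) = begin-equality
    eval ((c ∷ 1 ∷ []) ⊗ weighted 1 n (hist c n))       ≡⟨ eval-⊗ (c ∷ 1 ∷ []) (weighted 1 n (hist c n)) ⟩
    eval (c ∷ 1 ∷ []) * eval (weighted 1 n (hist c n))  ≡⟨ cong₂ _*_ eval-x (eval-weighted n 1) ⟩
    x * (factorial R n * tail 1 n)                      ≡⟨ solve 3 (λ x f v → x :* (f :* v) := f :* (x :* v)) refl x (factorial R n) (tail 1 n) ⟩
    factorial R n * (x * tail 1 n)                      ≡⟨ cong (factorial R n *_) (P-recurrence n) ⟨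
    factorial R n * (fromℕ R (suc n) * p (suc n))       ≡⟨ solve 3 (λ f m v → f :* (m :* v) := m :* f :* v) refl (factorial R n) (fromℕ R (suc n)) (p (suc n)) ⟩
    factorial R (suc n) * p (suc n)                     ∎
  eval-weighted zero k = begin-equality
    eval (σ k · poly c 0 ⊕ [])                          ≡⟨ eval-⊕ (σ k · poly c 0) [] ⟩
    eval (σ k · poly c 0) + 0#                          ≡⟨ cong (_+ 0#) (trans (eval-· (σ k) (poly c 0)) (cong (fromℕ R (σ k) *_) (eval-poly 0))) ⟩
    fromℕ R (σ k) * (1# * p 0) + 0#                     ≡⟨ solve 2 (λ s a → s :* (con 1 :* a) :+ con 0 := con 1 :* (s :* a)) refl (fromℕ R (σ k)) (p 0) ⟩
    1# * (fromℕ R (σ k) * p 0)                          ∎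
  eval-weighted (suc n) k = begin-equality
    eval (σ k · poly c (suc n) ⊕ suc n · w)
      ≡⟨ eval-⊕ (σ k · poly c (suc n)) (suc n · w) ⟩
    eval (σ k · poly c (suc n)) + eval (suc n · w)
      ≡⟨ cong₂ _+_ (trans (eval-· (σ k) (poly c (suc n))) (cong (fromℕ R (σ k) *_) (eval-poly (suc n))))
                   (trans (eval-· (suc n) w) (cong (fromℕ R (suc n) *_) (eval-weighted n (suc k)))) ⟩
    fromℕ R (σ k) * (factorial R (suc n) * p (suc n)) + fromℕ R (suc n) * (factorial R n * tail (suc k) n)
      ≡⟨ solve 5 (λ s m f a v → s :* (m :* f :* a) :+ m :* (f :* v) := m :* f :* (s :* a :+ v)) refl
           (fromℕ R (σ k)) (fromℕ R (suc n)) (factorial R n) (p (suc n)) (tail (suc k) n) ⟩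
    factorial R (suc n) * tail k (suc n) ∎
    where w = weighted (suc k) n (hist c n)

  -- The two products of polynomials carry the weights (n + 1)! b! and n! (b + 1)!; the multipliers
  -- `suc b` and `suc n` of the check bring both to (n + 1)! (b + 1)!, which cancels.
  ratio-certified : ∀ b N → T (descend (ratioCheck b (poly c b) (poly c (suc b))) N (hist c N)) →
                    ∀ n → b ℕ.< n → suc n ℕ.≤ N → p b * p (suc n) < p (suc b) * p n
  ratio-certified b N ok n b<n n<N
    with Equivalence.to (T-∨ {suc n ≤ᵇ suc b}) (descend-sound _ c N ok n<N)
  ... | inj₁ n≤b = ⊥-elim (ℕₚ.<⇒≱ b<n (s≤s⁻¹ (ℕₚ.≤ᵇ⇒≤ (suc n) (suc b) n≤b)))
  ... | inj₂ le  = *-cancelˡ-< (*-pos (factorial-pos (suc n)) (factorial-pos (suc b))) (begin-strict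
    factorial R (suc n) * factorial R (suc b) * (p b * p (suc n))
      ≡⟨ solve 5 (λ f m g a d → f :* (m :* g) :* (a :* d) := m :* (f :* d :* (g :* a))) refl
           (factorial R (suc n)) (fromℕ R (suc b)) (factorial R b) (p b) (p (suc n)) ⟩
    fromℕ R (suc b) * (factorial R (suc n) * p (suc n) * (factorial R b * p b))
      ≡⟨ cong₂ (λ u v → fromℕ R (suc b) * (u * v)) (eval-poly (suc n)) (eval-poly b) ⟨
    fromℕ R (suc b) * (eval (poly c (suc n)) * eval (poly c b))
      ≡⟨ trans (eval-· (suc b) (poly c (suc n) ⊗ poly c b)) (cong (fromℕ R (suc b) *_) (eval-⊗ (poly c (suc n)) (poly c b))) ⟨
    eval lhs
      ≡⟨ +-identityʳ _ ⟨
    eval lhs + 0#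
      <⟨ +-monoʳ-< _ 0<t ⟩
    eval lhs + t
      ≡⟨ cong (eval lhs +_) eval-t ⟨
    eval lhs + eval (0 ∷ 1 ∷ [])
      ≡⟨ eval-⊕ lhs (0 ∷ 1 ∷ []) ⟨
    eval (lhs ⊕ (0 ∷ 1 ∷ []))
      ≤⟨ eval-≼ (lhs ⊕ (0 ∷ 1 ∷ [])) (suc n · (poly c n ⊗ poly c (suc b))) le ⟩
    eval (suc n · (poly c n ⊗ poly c (suc b)))
      ≡⟨ trans (eval-· (suc n) (poly c n ⊗ poly c (suc b))) (cong (fromℕ R (suc n) *_) (eval-⊗ (poly c n) (poly c (suc b)))) ⟩
    fromℕ R (suc n) * (eval (poly c n) * eval (poly c (suc b)))
      ≡⟨ cong₂ (λ u v → fromℕ R (suc n) * (u * v)) (eval-poly n) (eval-poly (suc b)) ⟩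
    fromℕ R (suc n) * (factorial R n * p n * (factorial R (suc b) * p (suc b)))
      ≡⟨ solve 5 (λ m f a g d → m :* (f :* a :* (g :* d)) := m :* f :* g :* (d :* a)) refl
           (fromℕ R (suc n)) (factorial R n) (p n) (factorial R (suc b)) (p (suc b)) ⟩
    factorial R (suc n) * factorial R (suc b) * (p (suc b) * p n) ∎)
    where lhs = suc b · (poly c (suc n) ⊗ poly c b)

  fromℕ-! : ∀ n → fromℕ R (n !) ≡ factorial R n
  fromℕ-! zero    = +-identityʳ 1#
  fromℕ-! (suc n) = trans (fromℕ-* (suc n) (n !)) (cong (fromℕ R (suc n) *_) (fromℕ-! n))

  eval-scaled-poly : ∀ k n → eval (k · poly c n) ≡ fromℕ R (k ℕ.* n !) * p n
  eval-scaled-poly k n = begin-equality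
    eval (k · poly c n)                   ≡⟨ eval-· k (poly c n) ⟩
    fromℕ R k * eval (poly c n)           ≡⟨ cong (fromℕ R k *_) (eval-poly n) ⟩
    fromℕ R k * (factorial R n * p n)     ≡⟨ *-assoc _ _ _ ⟨
    fromℕ R k * factorial R n * p n       ≡⟨ cong (λ f → fromℕ R k * f * p n) (fromℕ-! n) ⟨
    fromℕ R k * fromℕ R (n !) * p n       ≡⟨ cong (_* p n) (fromℕ-* k (n !)) ⟨
    fromℕ R (k ℕ.* n !) * p n             ∎

  eval-sextuple : eval (sextuple c) ≡ fromℕ R 6 * Q
  eval-sextuple = begin-equality
    eval (6 · poly c 0 ⊕ 6 · poly c 1 ⊕ 3 · poly c 2 ⊕ 1 · poly c 3)
      ≡⟨ trans (eval-⊕ (6 · poly c 0 ⊕ 6 · poly c 1 ⊕ 3 · poly c 2) (1 · poly c 3)) (cong (_+ eval (1 · poly c 3))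
         (trans (eval-⊕ (6 · poly c 0 ⊕ 6 · poly c 1) (3 · poly c 2)) (cong (_+ eval (3 · poly c 2))
         (eval-⊕ (6 · poly c 0) (6 · poly c 1))))) ⟩
    eval (6 · poly c 0) + eval (6 · poly c 1) + eval (3 · poly c 2) + eval (1 · poly c 3)
      ≡⟨ cong₂ _+_ (cong₂ _+_ (cong₂ _+_ (eval-scaled-poly 6 0) (eval-scaled-poly 6 1)) (eval-scaled-poly 3 2)) (eval-scaled-poly 1 3) ⟩
    fromℕ R 6 * p 0 + fromℕ R 6 * p 1 + fromℕ R 6 * p 2 + fromℕ R 6 * p 3
      ≡⟨ solve 5 (λ k a b c d → k :* a :+ k :* b :+ k :* c :+ k :* d := k :* (a :+ b :+ c :+ d)) refl (fromℕ R 6) (p 0) (p 1) (p 2) (p 3) ⟩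
    fromℕ R 6 * Q ∎

  growth-certified : ∀ N → T (descend (growthCheck (sextuple c)) N (hist c N)) →
                     ∀ s → s ℕ.+ 3 ℕ.≤ N → fromℕ R (simplicial 5 s) * Q ≤ fromℕ R 300 * p (s ℕ.+ 3)
  growth-certified N ok s s+3≤N
    with Equivalence.to (T-∨ {s ℕ.+ 3 ≤ᵇ 2}) (descend-sound _ c N ok s+3≤N)
  ... | inj₁ le = ⊥-elim (ℕₚ.<⇒≱ (ℕₚ.m≤n+m 3 s) (ℕₚ.≤ᵇ⇒≤ (s ℕ.+ 3) 2 le))
  ... | inj₂ le = *-cancelˡ-≤ (*-pos (factorial-pos m) (*-pos (factorial-pos 5) (0<fromℕ-suc 5))) (begin
    M * (f₅ * fromℕ R 6) * (fromℕ R (simplicial 5 s) * Q)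
      ≡⟨ solve 5 (λ m f k s q → m :* (f :* k) :* (s :* q) := m :* (f :* s) :* (k :* q)) refl M f₅ (fromℕ R 6) (fromℕ R (simplicial 5 s)) Q ⟩
    M * (f₅ * fromℕ R (simplicial 5 s)) * (fromℕ R 6 * Q)
      ≡⟨ cong₂ _*_ coefficient eval-sextuple ⟨
    fromℕ R (m ! ℕ.* ascending (m ∸ 3) 5) * eval (sextuple c)
      ≡⟨ eval-· (m ! ℕ.* ascending (m ∸ 3) 5) (sextuple c) ⟨
    eval ((m ! ℕ.* ascending (m ∸ 3) 5) · sextuple c)
      ≤⟨ eval-≼ ((m ! ℕ.* ascending (m ∸ 3) 5) · sextuple c) (5 ! ℕ.* 1800 · poly c m) le ⟩
    eval (5 ! ℕ.* 1800 · poly c m)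
      ≡⟨ trans (eval-· (5 ! ℕ.* 1800) (poly c m)) (cong (fromℕ R (5 ! ℕ.* 1800) *_) (eval-poly m)) ⟩
    fromℕ R (5 ! ℕ.* 1800) * (M * p m)
      ≡⟨ cong (_* (M * p m)) (trans (fromℕ-* (5 !) 1800) (cong₂ _*_ (fromℕ-! 5) (fromℕ-* 6 300))) ⟩
    f₅ * (fromℕ R 6 * fromℕ R 300) * (M * p m)
      ≡⟨ solve 5 (λ f k l m a → f :* (k :* l) :* (m :* a) := m :* (f :* k) :* (l :* a)) refl f₅ (fromℕ R 6) (fromℕ R 300) M (p m) ⟩
    M * (f₅ * fromℕ R 6) * (fromℕ R 300 * p m) ∎)
    where
    m = s ℕ.+ 3
    M = factorial R m
    f₅ = factorial R 5
    coefficient : fromℕ R (m ! ℕ.* ascending (m ∸ 3) 5) ≡ M * (f₅ * fromℕ R (simplicial 5 s))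
    coefficient = begin-equality
      fromℕ R (m ! ℕ.* ascending (m ∸ 3) 5)                ≡⟨ cong (λ k → fromℕ R (m ! ℕ.* ascending k 5)) (ℕₚ.m+n∸n≡m s 3) ⟩
      fromℕ R (m ! ℕ.* ascending s 5)                      ≡⟨ cong (λ k → fromℕ R (m ! ℕ.* k)) (simplicial-ascending 5 s) ⟨
      fromℕ R (m ! ℕ.* (5 ! ℕ.* simplicial 5 s))           ≡⟨ trans (fromℕ-* (m !) _) (cong (fromℕ R (m !) *_) (fromℕ-* (5 !) (simplicial 5 s))) ⟩
      fromℕ R (m !) * (fromℕ R (5 !) * fromℕ R (simplicial 5 s)) ≡⟨ cong₂ (λ u v → u * (v * fromℕ R (simplicial 5 s))) (fromℕ-! m) (fromℕ-! 5) ⟩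
      M * (f₅ * fromℕ R (simplicial 5 s))                  ∎

-- Growth of P_n for x > 1 and the ratio inequalities for all n

module Growth (R : RealField) (x : RealField.Carrier R) (1<x : RealField._<_ R (fromℕ R 1) x) where
  open RealField R
  open OrderedField R
  open EulerFactor R x
  open Certificate R 1 x 1<x using (0<x)
  open Monotonicity R x 0<x
  open ≤-Reasoning

  Q-pos : 0# < Q
  Q-pos = <-≤-trans (p-pos 0) (sumTo-p-mono {0} {3} z≤n)

  -- The shift by 3 makes s = 0 compare Q with P_3, its own summand of highest degree in x. The
  -- constant is written `suc c`, hence visibly positive; it is used with c = 299.
  growth-at : ℕ → ℕ → Set
  growth-at c s = fromℕ R (simplicial 5 s) * Q ≤ fromℕ R (suc c) * p (s ℕ.+ 3)

  module _ (c : ℕ) (base : ∀ s → s ℕ.≤ 39 → growth-at c s)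
           (triangle-small : ∀ e → suc c ℕ.* 4 ℕ.* triangle (e ℕ.+ 44) ℕ.< simplicial 5 (e ℕ.+ 40)) where

    C : Carrier
    C = fromℕ R (suc c)

    -- Bounding σ(k) below by k turns the tail into a convolution of simplicial numbers.
    growth-tail : ∀ s k → (∀ j → j ℕ.≤ s → growth-at c j) →
                  fromℕ R (k ℕ.* simplicial 6 s ℕ.+ simplicial 7 s) * Q ≤ C * tail (suc k) (s ℕ.+ 3)
    growth-tail zero k growth = begin
      fromℕ R (k ℕ.* 1 ℕ.+ 1) * Q                     ≡⟨ cong (λ n → fromℕ R n * Q) (trans (cong (ℕ._+ 1) (ℕₚ.*-identityʳ k)) (ℕₚ.+-comm k 1)) ⟩
      fromℕ R (suc k) * Q                             ≡⟨ solve 2 (λ a q → a :* q := a :* ((con 1 :+ con 0) :* q)) refl (fromℕ R (suc k)) Q ⟩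
      fromℕ R (suc k) * (fromℕ R 1 * Q)               ≤⟨ *-monoʳ-≤ (0≤fromℕ (suc k)) (growth 0 z≤n) ⟩
      fromℕ R (suc k) * (C * p 3)           ≤⟨ *-monoˡ-≤ (*-nonneg (0≤fromℕ (suc c)) (p-nonneg 3)) (fromℕ-mono-≤ (k≤σ (suc k))) ⟩
      fromℕ R (σ (suc k)) * (C * p 3)       ≡⟨ solve 3 (λ s c a → s :* (c :* a) := c :* (s :* a)) refl (fromℕ R (σ (suc k))) C (p 3) ⟩
      -- Here the terms with P_0, P_1 and P_2, for which there is no growth bound, are discarded.
      C * (fromℕ R (σ (suc k)) * p 3)       ≤⟨ *-monoʳ-≤ (0≤fromℕ (suc c)) (tail-lower (suc k) 3) ⟩
      C * tail (suc k) 3                    ∎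
    growth-tail (suc s) k growth = begin
      fromℕ R (k ℕ.* S₆′ ℕ.+ (S₇ ℕ.+ S₆′)) * Q
        ≡⟨ cong (_* Q) split ⟩
      (fromℕ R (suc k) * fromℕ R S₅ + fromℕ R r) * Q
        ≡⟨ solve 4 (λ k a r q → (k :* a :+ r) :* q := k :* (a :* q) :+ r :* q) refl (fromℕ R (suc k)) (fromℕ R S₅) (fromℕ R r) Q ⟩
      fromℕ R (suc k) * (fromℕ R S₅ * Q) + fromℕ R r * Q
        ≤⟨ +-mono-≤ (*-monoʳ-≤ (0≤fromℕ (suc k)) (growth (suc s) ℕₚ.≤-refl))
                    (growth-tail s (suc k) (λ j j≤s → growth j (ℕₚ.m≤n⇒m≤1+n j≤s))) ⟩
      fromℕ R (suc k) * (C * p (suc s ℕ.+ 3)) + C * tail (suc (suc k)) (s ℕ.+ 3)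
        ≤⟨ +-monoˡ-≤ _ (*-monoˡ-≤ (*-nonneg (0≤fromℕ (suc c)) (p-nonneg (suc s ℕ.+ 3))) (fromℕ-mono-≤ (k≤σ (suc k)))) ⟩
      fromℕ R (σ (suc k)) * (C * p (suc s ℕ.+ 3)) + C * tail (suc (suc k)) (s ℕ.+ 3)
        ≡⟨ solve 4 (λ s c a v → s :* (c :* a) :+ c :* v := c :* (s :* a :+ v)) refl
             (fromℕ R (σ (suc k))) C (p (suc s ℕ.+ 3)) (tail (suc (suc k)) (s ℕ.+ 3)) ⟩
      C * tail (suc k) (suc s ℕ.+ 3) ∎
      where
      S₅ = simplicial 5 (suc s)
      S₆ = simplicial 6 s
      S₆′ = simplicial 6 (suc s)
      S₇ = simplicial 7 s
      r = suc k ℕ.* S₆ ℕ.+ S₇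
      split : fromℕ R (k ℕ.* S₆′ ℕ.+ (S₇ ℕ.+ S₆′)) ≡ fromℕ R (suc k) * fromℕ R S₅ + fromℕ R r
      split = begin-equality
        fromℕ R (k ℕ.* S₆′ ℕ.+ (S₇ ℕ.+ S₆′))       ≡⟨ cong (fromℕ R) (simplicial-step k s) ⟩
        fromℕ R (suc k ℕ.* S₅ ℕ.+ r)               ≡⟨ fromℕ-+ (suc k ℕ.* S₅) r ⟩
        fromℕ R (suc k ℕ.* S₅) + fromℕ R r         ≡⟨ cong (_+ fromℕ R r) (fromℕ-* (suc k) S₅) ⟩
        fromℕ R (suc k) * fromℕ R S₅ + fromℕ R r   ∎

    growth : ∀ s → growth-at c s
    growth = <-rec (growth-at c) step
      where
      step : ∀ s → (∀ {j} → j ℕ.< s → growth-at c j) → growth-at c s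
      step s rec with s ℕₚ.≤? 39
      ... | yes s≤39 = base s s≤39
      step zero    rec | no 0≰39 = ⊥-elim (0≰39 z≤n)
      step (suc s) rec | no s≰39 = *-cancelˡ-≤ (0<fromℕ-suc (s ℕ.+ 3)) (begin
        fromℕ R (suc s ℕ.+ 3) * (fromℕ R (simplicial 5 (suc s)) * Q)
          ≡⟨ trans (cong (_* Q) (fromℕ-* (suc s ℕ.+ 3) (simplicial 5 (suc s)))) (*-assoc _ _ _) ⟨
        fromℕ R ((suc s ℕ.+ 3) ℕ.* simplicial 5 (suc s)) * Q
          ≤⟨ *-monoˡ-≤ (inj₁ Q-pos) (fromℕ-mono-≤ (simplicial-growth s (s≤s⁻¹ (ℕₚ.≰⇒> s≰39)))) ⟩
        fromℕ R (simplicial 7 s) * Q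
          ≤⟨ growth-tail s 0 (λ j j≤s → rec (s≤s j≤s)) ⟩
        C * tail 1 (s ℕ.+ 3)
          -- The inductive step uses x > 1 only here, to insert the factor x of the recurrence.
          ≤⟨ *-monoʳ-≤ (0≤fromℕ (suc c)) (≤-trans (≤-reflexive (solve 1 (λ v → v := (con 1 :+ con 0) :* v) refl _))
                                              (*-monoˡ-≤ (tail-nonneg 1 (s ℕ.+ 3)) (inj₁ 1<x))) ⟩
        C * (x * tail 1 (s ℕ.+ 3))
          ≡⟨ cong (C *_) (P-recurrence (s ℕ.+ 3)) ⟨
        C * (fromℕ R (suc s ℕ.+ 3) * p (suc s ℕ.+ 3))
          ≡⟨ solve 3 (λ c m a → c :* (m :* a) := m :* (c :* a)) refl C (fromℕ R (suc s ℕ.+ 3)) (p (suc s ℕ.+ 3)) ⟩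
        fromℕ R (suc s ℕ.+ 3) * (C * p (suc s ℕ.+ 3)) ∎)

    -- For n = e + 43 the recurrence for P_{n+1} involves σ up to the argument n + 1 = e + 44, while
    -- the growth bound for P_n has s = n - 3 = e + 40.
    P-large : ∀ e → fromℕ R 4 * (fromℕ R (triangle (e ℕ.+ 44)) * Q) < p (e ℕ.+ 43)
    P-large e = *-cancelˡ-< (0<fromℕ-suc c) (begin-strict
      C * (fromℕ R 4 * (fromℕ R Δ′ * Q))
        ≡⟨ solve 4 (λ a b d q → a :* (b :* (d :* q)) := q :* (a :* b :* d)) refl (C) (fromℕ R 4) (fromℕ R Δ′) Q ⟩
      Q * (C * fromℕ R 4 * fromℕ R Δ′)
        ≡⟨ cong (Q *_) (trans (fromℕ-* (suc c ℕ.* 4) Δ′) (cong (_* fromℕ R Δ′) (fromℕ-* (suc c) 4))) ⟨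
      Q * fromℕ R (suc c ℕ.* 4 ℕ.* Δ′)
        <⟨ *-monoʳ-< Q-pos (fromℕ-mono-< (triangle-small e)) ⟩
      Q * fromℕ R (simplicial 5 (e ℕ.+ 40))
        ≡⟨ *-comm _ _ ⟩
      fromℕ R (simplicial 5 (e ℕ.+ 40)) * Q
        ≤⟨ growth (e ℕ.+ 40) ⟩
      C * p (e ℕ.+ 40 ℕ.+ 3)
        ≡⟨ cong (λ n → C * p n) (ℕₚ.+-assoc e 40 3) ⟩
      C * p (e ℕ.+ 43) ∎)
      where Δ′ = triangle (e ℕ.+ 44)

    module _ (b : ℕ) (b≤3 : b ℕ.≤ 3) where

      Decreasing : ℕ → Set
      Decreasing n = p b * p (suc n) < p (suc b) * p n

      decreasing-far : ∀ e {n} → suc (e ℕ.+ b) ≡ n → 42 ℕ.< n → (∀ {m} → m ℕ.< n → b ℕ.< m → Decreasing m) → Decreasing n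
      decreasing-far e refl n>42 rec = ratio-step b e b≤3 earlier large
        where
        earlier : ∀ i → i ℕ.≤ e → p b * p (suc (i ℕ.+ b)) ≤ p (suc b) * p (i ℕ.+ b)
        -- At index b the two products coincide; the strict induction hypothesis begins at b + 1.
        earlier zero    _   = ≤-reflexive (*-comm _ _)
        earlier (suc i) i<e = inj₁ (rec (s≤s (ℕₚ.+-monoˡ-≤ b i<e)) (s≤s (ℕₚ.m≤n+m b i)))
        n = suc (e ℕ.+ b)
        large : fromℕ R 4 * (fromℕ R (triangle (suc n)) * Q) < p n
        large = subst (λ n → fromℕ R 4 * (fromℕ R (triangle (suc n)) * Q) < p n) (ℕₚ.m∸n+n≡m n>42)
                  (subst (λ k → fromℕ R 4 * (fromℕ R (triangle k) * Q) < p (n ∸ 43 ℕ.+ 43)) (ℕₚ.+-suc (n ∸ 43) 43) (P-large (n ∸ 43)))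

      ratio-decreasing : (∀ n → b ℕ.< n → n ℕ.≤ 42 → Decreasing n) → ∀ n → b ℕ.< n → Decreasing n
      ratio-decreasing near = <-rec (λ n → b ℕ.< n → Decreasing n) step
        where
        step : ∀ n → (∀ {m} → m ℕ.< n → b ℕ.< m → Decreasing m) → b ℕ.< n → Decreasing n
        step n rec b<n with n ℕₚ.≤? 42
        ... | yes n≤42 = near n b<n n≤42
        ... | no n≰42  = decreasing-far (n ∸ suc b) (trans (sym (ℕₚ.+-suc _ b)) (ℕₚ.m∸n+n≡m b<n)) (ℕₚ.≰⇒> n≰42) rec

-- Assembly of the three cases

module _ (R : RealField) (x : RealField.Carrier R) (1<x : RealField._<_ R (fromℕ R 1) x) where
  open RealField R
  open OrderedField R

  growth-base : ∀ s → s ℕ.≤ 39 → Growth.growth-at R x 1<x 299 s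
  growth-base s s≤39 = Certificate.growth-certified R 1 x 1<x 42 growthCheck₁ s (ℕₚ.+-monoˡ-≤ 3 s≤39)

  Δ-pos : ∀ b → b ℕ.≤ 3 → (∀ n → b ℕ.< n → n ℕ.≤ 42 → P R b x * P R (suc n) x < P R (suc b) x * P R n x) →
          ∀ a → b ℕ.+ 2 ℕ.≤ a → 0# < Δ R a b x
  Δ-pos b b≤3 base zero    b+2≤0 with () ← ℕₚ.≤-trans (ℕₚ.m≤n+m 2 b) b+2≤0
  Δ-pos b b≤3 base (suc n) b+2≤a = x<y⇒0<y-x (begin-strict
    P R (suc n) x * P R b x   ≡⟨ *-comm _ _ ⟩
    P R b x * P R (suc n) x   <⟨ Growth.ratio-decreasing R x 1<x 299 growth-base triangle-growth b b≤3 base n (s≤s⁻¹ (ℕₚ.≤-trans (ℕₚ.≤-reflexive (ℕₚ.+-comm 2 b)) b+2≤a)) ⟩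
    P R (suc b) x * P R n x   ≡⟨ *-comm _ _ ⟩
    P R n x * P R (suc b) x   ∎)
    where open ≤-Reasoning

  ratio-certified₁ : ∀ b → T (descend (ratioCheck b (poly 1 b) (poly 1 (suc b))) 43 (hist 1 43)) →
                     ∀ n → b ℕ.< n → n ℕ.≤ 42 → P R b x * P R (suc n) x < P R (suc b) x * P R n x
  ratio-certified₁ b ok n b<n n≤42 = Certificate.ratio-certified R 1 x 1<x b 43 ok n b<n (s≤s n≤42)

open import Data.Nat using (_≤_; _+_)

theorem2 : (R : RealField) → (b : ℕ) → 1 ≤ b → b ≤ 3 →
    (a : ℕ) → b + 2 ≤ a →
    (x : RealField.Carrier R) → RealField._<_ R (fromℕ R (x₀ b)) x →
    RealField._<_ R (RealField.0# R) (Δ R a b x)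
theorem2 R 1 _ b≤3 a b+2≤a x x₀<x = Δ-pos R x x₀<x 1 b≤3 (ratio-certified₁ R x x₀<x 1 ratioCheck₁) a b+2≤a
theorem2 R 2 _ b≤3 a b+2≤a x x₀<x =
  -- The range of large n needs only x > 1, so 2 < x is weakened there; its full strength enters
  -- through the certificate in t = x - 2.
  Δ-pos R x (<-trans (fromℕ-mono-< {1} {2} (s≤s (s≤s z≤n))) x₀<x) 2 b≤3
    (λ n b<n n≤42 → Certificate.ratio-certified R 2 x x₀<x 2 43 ratioCheck₂ n b<n (s≤s n≤42)) a b+2≤a
  where open OrderedField R
theorem2 R 3 _ b≤3 a b+2≤a x x₀<x = Δ-pos R x x₀<x 3 b≤3 (ratio-certified₁ R x x₀<x 3 ratioCheck₃) a b+2≤a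
theorem2 R (suc (suc (suc (suc b)))) _ (s≤s (s≤s (s≤s ()))) a b+2≤a x x₀<x
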